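{- Let $\dot G\in\mathcal C_1\cup\mathcal C_4\cup\mathcal C_5$ be a connected, non-complete, $6$-regular and $2$ net-regular strongly regular signed graph with parameters $(n,6,a,b,c)$. Then: (1) $a\neq-3$; (2) if $a=-4$, then $\dot G$ is isomorphic to $\dot S^2_8$, which has parameters $(8,6,-4,4,6)$; (3) $b\neq 5$; (4) if $b=4$, then $a=-4$. Here $\dot S^2_8$ is the signed graph on vertex set $\{1,\dots,8\}$ whose underlying graph is $K_8$ minus the perfect matching $\{18,27,34,56\}$. Its negative edges are $23,24,15,16,37,47,58,68$, and all its other edges are positive.
   Context: Signed graphs. - A signed graph $\dot G=(G,\sigma)$ is a simple graph $G$ (the underlying graph) with a sign function $\sigma:E(G)\to\{\pm1\}$. - The adjacency matrix has entries $\sigma(v_iv_j)$ for adjacent pairs and $0$ otherwise. - Connected, complete and regular refer to $G$. - $\dot G$ is $\rho$ net-regular if every vertex has (number of positive incident edges) $-$ (number of negative incident edges) $=\rho$. - $\dot G$ is homogeneous if all edges have the same sign. - Isomorphism of signed graphs means a graph isomorphism preserving signs. Strongly regular signed graphs. - An SRSG is a signed graph on $n$ vertices, neither homogeneous complete nor edgeless, for which there are $r\in\mathbb N$ and $a,b,c\in\mathbb Z$ such that the entries of $A(\dot G)^2$ are: - $r$ on the diagonal; - $a$ for pairs joined by a positive edge; - $b$ for pairs joined by a negative edge; - $c$ for distinct non-adjacent pairs. - $(n,r,a,b,c)$ are its parameters. Classes of inhomogeneous SRSGs. - $\mathcal C_1$: $a=-b$, and either complete, or non-complete with $c\ne0$.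 - $\mathcal C_4$: $a\ne-b$, non-complete, $c=0$. - $\mathcal C_5$: $a\ne-b$, non-complete, $c\ne\frac{a+b}2$ and $c\neq0$. -}

module Defs where

open import Data.Nat as ℕ using (ℕ; zero; suc; _≡ᵇ_)
open import Data.Integer using (ℤ; +_; -_; _+_; _-_; _*_; 0ℤ; 1ℤ; -1ℤ)
import Data.Integer as ℤ
open import Data.Fin using (Fin; toℕ)
import Data.Fin as Fin
open import Data.Bool using (Bool; true; false; if_then_else_; _∨_)
open import Data.Product using (Σ; _×_; _,_)
open import Data.Sum using (_⊎_)
open import Relation.Nullary using (¬_)
open import Relation.Nullary.Decidable using (⌊_⌋)
open import Relation.Binary.PropositionalEquality using (_≡_; _≢_)
open import Function.Bundles using (_↔_; Inverse)

-- A signed graph on vertex set Fin n, given by its adjacency matrix: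
-- entry σ(ij) ∈ {1,-1} if ij is an edge, 0 otherwise.
SMat : ℕ → Set
SMat n = Fin n → Fin n → ℤ

-- Well-formedness: symmetric, zero diagonal (simple graph), entries in {0,1,-1}.
record IsSignedGraph {n : ℕ} (A : SMat n) : Set where
  field
    symm     : ∀ i j → A i j ≡ A j i
    loopless : ∀ i → A i i ≡ 0ℤ
    entries  : ∀ i j → A i j ≡ 0ℤ ⊎ A i j ≡ 1ℤ ⊎ A i j ≡ -1ℤ

-- sum over Fin n
sumF : ∀ {n} → (Fin n → ℤ) → ℤ
sumF {zero}  f = 0ℤ
sumF {suc n} f = f Fin.zero + sumF (λ k → f (Fin.suc k))

-- entries of A²
sq : ∀ {n} → SMat n → Fin n → Fin n → ℤ
sq A i j = sumF (λ k → A i k * A k j)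

indicator : Bool → ℤ
indicator b = if b then 1ℤ else 0ℤ

-- number of neighbours, positive neighbours, negative neighbours
degree : ∀ {n} → SMat n → Fin n → ℤ
degree A i = sumF (λ k → indicator (Data.Bool.not ⌊ A i k ℤ.≟ 0ℤ ⌋))
  where import Data.Bool

posDeg negDeg : ∀ {n} → SMat n → Fin n → ℤ
posDeg A i = sumF (λ k → indicator ⌊ A i k ℤ.≟ 1ℤ ⌋)
negDeg A i = sumF (λ k → indicator ⌊ A i k ℤ.≟ -1ℤ ⌋)

Regular : ∀ {n} → SMat n → ℕ → Set
Regular A r = ∀ i → degree A i ≡ + r

NetRegular : ∀ {n} → SMat n → ℤ → Set
NetRegular A ρ = ∀ i → posDeg A i - negDeg A i ≡ ρ

Complete : ∀ {n} → SMat n → Set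
Complete A = ∀ i j → i ≢ j → A i j ≢ 0ℤ

Edgeless : ∀ {n} → SMat n → Set
Edgeless A = ∀ i j → A i j ≡ 0ℤ

-- all edges have the same sign
Homogeneous : ∀ {n} → SMat n → Set
Homogeneous A = (∀ i j → A i j ≢ -1ℤ) ⊎ (∀ i j → A i j ≢ 1ℤ)

-- walks in the underlying graph
data Reach {n} (A : SMat n) : Fin n → Fin n → Set where
  here : ∀ {i} → Reach A i i
  step : ∀ {i j k} → A i j ≢ 0ℤ → Reach A j k → Reach A i k

Connected : ∀ {n} → SMat n → Set
Connected A = ∀ i j → Reach A i j

-- strongly regular signed graph with parameters (n, r, a, b, c)
record IsSRSG {n : ℕ} (A : SMat n) (r : ℕ) (a b c : ℤ) : Set where
  field
    notHomComplete : ¬ (Homogeneous A × Complete A)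
    notEdgeless    : ¬ Edgeless A
    diag : ∀ i → sq A i i ≡ + r
    pos  : ∀ i j → A i j ≡ 1ℤ → sq A i j ≡ a
    neg  : ∀ i j → A i j ≡ -1ℤ → sq A i j ≡ b
    non  : ∀ i j → i ≢ j → A i j ≡ 0ℤ → sq A i j ≡ c

-- classes of inhomogeneous SRSGs (c ≠ (a+b)/2 written as 2c ≠ a+b)
C₁ : ∀ {n} → SMat n → ℤ → ℤ → ℤ → Set
C₁ A a b c = ¬ Homogeneous A × a ≡ - b × (Complete A ⊎ (¬ Complete A × c ≢ 0ℤ))

C₄ : ∀ {n} → SMat n → ℤ → ℤ → ℤ → Set
C₄ A a b c = ¬ Homogeneous A × a ≢ - b × ¬ Complete A × c ≡ 0ℤ

C₅ : ∀ {n} → SMat n → ℤ → ℤ → ℤ → Set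
C₅ A a b c = ¬ Homogeneous A × a ≢ - b × ¬ Complete A × (+ 2) * c ≢ a + b × c ≢ 0ℤ

-- isomorphism: a bijection of vertex sets preserving (signed) adjacency
Iso : ∀ {n m} → SMat n → SMat m → Set
Iso {n} {m} A B = Σ (Fin n ↔ Fin m) λ f →
  ∀ i j → B (Inverse.to f i) (Inverse.to f j) ≡ A i j

-- The signed graph S²₈ (vertices labelled 1..8 as in the paper; Fin 8 index k ↔ label k+1)
private
  matching : ℕ → ℕ → Bool
  matching 1 8 = true
  matching 8 1 = true
  matching 2 7 = true
  matching 7 2 = true
  matching 3 4 = true
  matching 4 3 = true
  matching 5 6 = true
  matching 6 5 = true
  matching _ _ = false

  negative : ℕ → ℕ → Bool
  negative 2 3 = true
  negative 3 2 = true
  negative 2 4 = true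
  negative 4 2 = true
  negative 1 5 = true
  negative 5 1 = true
  negative 1 6 = true
  negative 6 1 = true
  negative 3 7 = true
  negative 7 3 = true
  negative 4 7 = true
  negative 7 4 = true
  negative 5 8 = true
  negative 8 5 = true
  negative 6 8 = true
  negative 8 6 = true
  negative _ _ = false

  s8 : ℕ → ℕ → ℤ
  s8 i j = if (i ≡ᵇ j) ∨ matching i j then 0ℤ
           else if negative i j then -1ℤ else 1ℤ

S²₈ : SMat 8
S²₈ i j = s8 (suc (toℕ i)) (suc (toℕ j))

-- A 6-regular, 2-net-regular signed graph has 4 positive and 2 negative neighbours at every
-- vertex. For vertices u, v let w⁺⁺, w⁻⁻, w⁺⁻, w⁻⁺ count the walks u – w – v by the signs of uw
-- and wv: then A²(u,v) = w⁺⁺ + w⁻⁻ − w⁺⁻ − w⁻⁺, the four counts add up to the number of common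
-- neighbours (at most 5 on an edge), and they are bounded by 4 and 2. Writing
-- A² = (6 − c)I + (a − c)P + (b − c)N + cJ and comparing A·A² with A²·A gives
-- (a + b − 2c)(w⁺⁻ − w⁻⁺) = 0; in the classes C₁, C₄, C₅ either c = 0, and then the row sums of A²
-- give 6 + 4a + 2b = 4, or a + b ≠ 2c, and then w⁺⁻ = w⁻⁺ everywhere. Either way the prescribed
-- value of a or b fixes the walk counts on every edge, and these local rules force the global
-- shape. For b = 5 a vertex p and its two negative neighbours form a negative triangle, which
-- together with one more vertex fills the positive neighbourhood of a positive neighbour of p,
-- leaving no room for the negative neighbours of that fourth vertex. For a = −3 adjacency is
-- transitive, so a connected graph would be complete. For b = 4 the two negative neighbours of a
-- vertex share a positive neighbour, which leaves a ∈ {−4, −3}. For a = −4 the rules pin down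
-- eight vertices spanning a copy of S²₈ that is closed under adjacency, hence all of the graph.

module Submission where

open import Defs
open import Level using (Level)
open import Function using (_∘_; id; case_of_)
open import Function.Bundles using (_↔_)
open import Data.Empty using (⊥; ⊥-elim)
open import Data.Product using (∃; ∃₂; _×_; _,_; proj₁; proj₂)
open import Data.Sum as Sum using (_⊎_; inj₁; inj₂; [_,_]′)
open import Data.Bool using (_∧_; not)
open import Data.Bool.Properties using (∧-comm)
open import Data.Sign as Sign using (Sign)
open import Data.Nat as ℕ using (ℕ; zero; suc)
import Data.Nat.Properties as ℕP
open import Data.Integer as ℤ using (ℤ; +_; -_; _+_; _-_; _*_; 0ℤ; 1ℤ; -1ℤ; _≤_; _◃_)
import Data.Integer.Properties as ℤP
open import Data.Integer.Tactic.RingSolver using (solve-∀)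
open import Data.Fin as Fin using (Fin; zero; suc; _≟_; toℕ)
import Data.Fin.Properties as FinP
open import Data.List using (List; []; _∷_; _++_; length; filter; map; allFin)
open import Data.List.Properties using (length-map)
open import Data.List.Relation.Unary.Any using (here; there; any?)
open import Data.List.Relation.Unary.All using (All; []; _∷_)
import Data.List.Relation.Unary.All as All
open import Data.List.Relation.Unary.All.Properties using (all-filter) renaming (map⁺ to All-map⁺)
open import Data.List.Relation.Unary.AllPairs using ([]; _∷_)
open import Data.List.Relation.Unary.Unique.Propositional using (Unique)
open import Data.List.Relation.Unary.Unique.Propositional.Properties
  using (Unique[x∷xs]⇒x∉xs; ++⁺; filter⁺; allFin⁺)
import Data.List.Relation.Unary.Unique.Propositional.Properties as Unique
open import Data.List.Membership.Propositional using (_∈_; _∉_)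
open import Data.List.Membership.Propositional.Properties using (∈-map⁻)
open import Relation.Nullary using (¬_; ¬?; Dec; yes; no; does; _×-dec_; _⊎-dec_; _→-dec_)
open import Relation.Nullary.Decidable using (isYes≗does; True; toWitness)
open import Relation.Unary using (Pred; Decidable; _⊆_; _∪_; _∩_)
open import Relation.Unary.Properties using (_∪?_; _∩?_)
open import Relation.Binary.PropositionalEquality
open import Algebra.Properties.Semiring.Sum ℤP.+-*-semiring
  using (sum; sum-cong-≗; sum-replicate-zero; ∑-distrib-+; ∑-comm; *-distribˡ-sum)

private
  variable
    n : ℕ
    p q : Level

sumF≡sum : (f : Fin n → ℤ) → sumF f ≡ sum f
sumF≡sum {zero}  f = refl
sumF≡sum {suc n} f = cong (_+_ (f zero)) (sumF≡sum (λ k → f (suc k)))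

sumF-cong : {f g : Fin n → ℤ} → (∀ k → f k ≡ g k) → sumF f ≡ sumF g
sumF-cong {f = f} {g} f≗g = trans (sumF≡sum f) (trans (sum-cong-≗ f≗g) (sym (sumF≡sum g)))

sumF-zero : ∀ n → sumF {n} (λ _ → 0ℤ) ≡ 0ℤ
sumF-zero n = trans (sumF≡sum {n} (λ _ → 0ℤ)) (sum-replicate-zero n)

sumF-distrib-+ : (f g : Fin n → ℤ) → sumF (λ k → f k + g k) ≡ sumF f + sumF g
sumF-distrib-+ f g = trans (sumF≡sum (λ k → f k + g k))
  (trans (∑-distrib-+ f g) (sym (cong₂ _+_ (sumF≡sum f) (sumF≡sum g))))

*-distribˡ-sumF : (x : ℤ) (f : Fin n → ℤ) → sumF (λ k → x * f k) ≡ x * sumF f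
*-distribˡ-sumF x f = trans (sumF≡sum (λ k → x * f k))
  (trans (sym (*-distribˡ-sum x f)) (sym (cong (x *_) (sumF≡sum f))))

*-distribʳ-sumF : (x : ℤ) (f : Fin n → ℤ) → sumF (λ k → f k * x) ≡ sumF f * x
*-distribʳ-sumF x f = trans (sumF-cong (λ k → ℤP.*-comm (f k) x)) (trans (*-distribˡ-sumF x f) (ℤP.*-comm x (sumF f)))

sumF-distrib-- : (f g : Fin n → ℤ) → sumF (λ k → f k - g k) ≡ sumF f - sumF g
sumF-distrib-- {zero}  f g = refl
sumF-distrib-- {suc n} f g =
  trans (cong (_+_ (f zero - g zero)) (sumF-distrib-- (λ k → f (suc k)) (λ k → g (suc k))))
        (rearrange (f zero) (g zero) _ _)
  where
  rearrange : ∀ a b c d → a - b + (c - d) ≡ a + c - (b + d)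
  rearrange = solve-∀

sumF-distrib-+-- : (f g h l : Fin n → ℤ) →
  sumF (λ k → f k + g k - h k - l k) ≡ sumF f + sumF g - sumF h - sumF l
sumF-distrib-+-- f g h l = begin
  sumF (λ k → f k + g k - h k - l k)    ≡⟨ sumF-distrib-- (λ k → f k + g k - h k) l ⟩
  sumF (λ k → f k + g k - h k) - sumF l ≡⟨ cong (_- sumF l) (sumF-distrib-- (λ k → f k + g k) h) ⟩
  sumF (λ k → f k + g k) - sumF h - sumF l ≡⟨ cong (λ x → x - sumF h - sumF l) (sumF-distrib-+ f g) ⟩
  sumF f + sumF g - sumF h - sumF l     ∎
  where open ≡-Reasoning

sumF-distrib-+++ : (f g h l : Fin n → ℤ) →
  sumF (λ k → f k + g k + h k + l k) ≡ sumF f + sumF g + sumF h + sumF l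
sumF-distrib-+++ f g h l = begin
  sumF (λ k → f k + g k + h k + l k)    ≡⟨ sumF-distrib-+ (λ k → f k + g k + h k) l ⟩
  sumF (λ k → f k + g k + h k) + sumF l ≡⟨ cong (_+ sumF l) (sumF-distrib-+ (λ k → f k + g k) h) ⟩
  sumF (λ k → f k + g k) + sumF h + sumF l ≡⟨ cong (λ x → x + sumF h + sumF l) (sumF-distrib-+ f g) ⟩
  sumF f + sumF g + sumF h + sumF l     ∎
  where open ≡-Reasoning

sumF-affine : (x f g h : Fin n → ℤ) (α β γ ε : ℤ) →
  sumF (λ k → x k * (α * f k + β * g k + γ * h k + ε))
    ≡ α * sumF (λ k → x k * f k) + β * sumF (λ k → x k * g k) + γ * sumF (λ k → x k * h k) + ε * sumF x
sumF-affine x f g h α β γ ε = begin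
  sumF (λ k → x k * (α * f k + β * g k + γ * h k + ε))
    ≡⟨ sumF-cong (λ k → distribute α β γ ε (x k) (f k) (g k) (h k)) ⟩
  sumF (λ k → α * (x k * f k) + β * (x k * g k) + γ * (x k * h k) + ε * x k)
    ≡⟨ sumF-distrib-+++ (λ k → α * (x k * f k)) (λ k → β * (x k * g k)) (λ k → γ * (x k * h k)) (λ k → ε * x k) ⟩
  sumF (λ k → α * (x k * f k)) + sumF (λ k → β * (x k * g k)) + sumF (λ k → γ * (x k * h k)) + sumF (λ k → ε * x k)
    ≡⟨ cong₂ _+_ (cong₂ _+_ (cong₂ _+_ (*-distribˡ-sumF α (λ k → x k * f k)) (*-distribˡ-sumF β (λ k → x k * g k)))
                                (*-distribˡ-sumF γ (λ k → x k * h k)))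
                 (*-distribˡ-sumF ε x) ⟩
  α * sumF (λ k → x k * f k) + β * sumF (λ k → x k * g k) + γ * sumF (λ k → x k * h k) + ε * sumF x
    ∎
  where
  open ≡-Reasoning
  distribute : ∀ α β γ ε x f g h → x * (α * f + β * g + γ * h + ε) ≡ α * (x * f) + β * (x * g) + γ * (x * h) + ε * x
  distribute = solve-∀

sumF-comm : ∀ {m} (f : Fin n → Fin m → ℤ) →
            sumF (λ i → sumF (λ j → f i j)) ≡ sumF (λ j → sumF (λ i → f i j))
sumF-comm f = trans (sumF≡sum² f) (trans (∑-comm f) (sym (sumF≡sum² (λ j i → f i j))))
  where
  sumF≡sum² : ∀ {n m} (h : Fin n → Fin m → ℤ) →
              sumF (λ i → sumF (h i)) ≡ sum (λ i → sum (h i))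
  sumF≡sum² h = trans (sumF≡sum (λ i → sumF (h i))) (sum-cong-≗ (λ i → sumF≡sum (h i)))

sumF-mono-≤ : {f g : Fin n → ℤ} → (∀ k → f k ≤ g k) → sumF f ≤ sumF g
sumF-mono-≤ {zero}  f≤g = ℤP.≤-refl
sumF-mono-≤ {suc n} f≤g = ℤP.+-mono-≤ (f≤g zero) (sumF-mono-≤ (λ k → f≤g (suc k)))

+-tight : ∀ {a b c d} → a ≤ b → c ≤ d → a + c ≡ b + d → a ≡ b × c ≡ d
+-tight {a} {b} {c} {d} a≤b c≤d eq =
  left-tight a≤b c≤d eq , left-tight c≤d a≤b (trans (ℤP.+-comm c a) (trans eq (ℤP.+-comm b d)))
  where
  left-tight : ∀ {a b c d} → a ≤ b → c ≤ d → a + c ≡ b + d → a ≡ b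
  left-tight {a} {b} a≤b c≤d eq with a ℤP.≟ b
  ... | yes a≡b = a≡b
  ... | no a≢b  = ⊥-elim (ℤP.<⇒≢ (ℤP.+-mono-<-≤ (ℤP.≤∧≢⇒< a≤b a≢b) c≤d) eq)

sumF-tight : {f g : Fin n → ℤ} → (∀ k → f k ≤ g k) → sumF f ≡ sumF g → ∀ k → f k ≡ g k
sumF-tight {suc n} f≤g eq zero    = proj₁ (+-tight (f≤g zero) (sumF-mono-≤ (λ k → f≤g (suc k))) eq)
sumF-tight {suc n} f≤g eq (suc k) =
  sumF-tight (λ k → f≤g (suc k)) (proj₂ (+-tight (f≤g zero) (sumF-mono-≤ (λ k → f≤g (suc k))) eq)) k

sumF≢0⇒∃≢0 : {f : Fin n → ℤ} → sumF f ≢ 0ℤ → ∃ λ k → f k ≢ 0ℤ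
sumF≢0⇒∃≢0 {zero}      sum≢0 = ⊥-elim (sum≢0 refl)
sumF≢0⇒∃≢0 {suc n} {f} sum≢0 with f zero ℤP.≟ 0ℤ
... | no f0≢0 = zero , f0≢0
... | yes f0≡0 with sumF≢0⇒∃≢0 (λ rest≡0 → sum≢0 (cong₂ _+_ f0≡0 rest≡0))
...   | k , fk≢0 = suc k , fk≢0

𝟙 : {P : Set p} → Dec P → ℤ
𝟙 P? = indicator (does P?)

𝟙-nonneg : ∀ {P : Set p} (P? : Dec P) → 0ℤ ≤ 𝟙 P?
𝟙-nonneg (yes _) = ℤ.+≤+ ℕ.z≤n
𝟙-nonneg (no _)  = ℤP.≤-refl

𝟙-mono : ∀ {P : Set p} {Q : Set q} → (P → Q) → (P? : Dec P) (Q? : Dec Q) → 𝟙 P? ≤ 𝟙 Q?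
𝟙-mono P⇒Q (yes p) (yes _) = ℤP.≤-refl
𝟙-mono P⇒Q (yes p) (no ¬q) = ⊥-elim (¬q (P⇒Q p))
𝟙-mono P⇒Q (no _)  Q?      = 𝟙-nonneg Q?

𝟙≢0⇒ : ∀ {P : Set p} (P? : Dec P) → 𝟙 P? ≢ 0ℤ → P
𝟙≢0⇒ (yes p) _   = p
𝟙≢0⇒ (no _)  0≢0 = ⊥-elim (0≢0 refl)

count : {P : Pred (Fin n) p} → Decidable P → ℤ
count P? = sumF (λ k → 𝟙 (P? k))

sumF-sift : (f : Fin n → ℤ) (v : Fin n) → sumF (λ k → f k * 𝟙 (k ≟ v)) ≡ f v
sumF-sift {suc n} f zero = begin
  f zero * 1ℤ + sumF (λ k → f (suc k) * 0ℤ)  ≡⟨ cong₂ _+_ (ℤP.*-identityʳ (f zero))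
                                                       (trans (sumF-cong (λ k → ℤP.*-zeroʳ (f (suc k)))) (sumF-zero n)) ⟩
  f zero + 0ℤ                                 ≡⟨ ℤP.+-identityʳ (f zero) ⟩
  f zero                                      ∎
  where open ≡-Reasoning
sumF-sift {suc n} f (suc v) =
  trans (cong (_+ rest) (ℤP.*-zeroʳ (f zero))) (trans (ℤP.+-identityˡ rest) (sumF-sift (λ k → f (suc k)) v))
  where
  rest : ℤ
  rest = sumF (λ k → f (suc k) * 𝟙 (k ≟ v))

𝟙-≟-sym : (i j : Fin n) → 𝟙 (i ≟ j) ≡ 𝟙 (j ≟ i)
𝟙-≟-sym i j with i ≟ j | j ≟ i
... | yes _   | yes _   = refl
... | no _    | no _    = refl
... | yes i≡j | no j≢i  = ⊥-elim (j≢i (sym i≡j))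
... | no i≢j  | yes j≡i = ⊥-elim (i≢j (sym j≡i))

count-≟ : (v : Fin n) → count (_≟ v) ≡ 1ℤ
count-≟ v = trans (sumF-cong (λ k → sym (ℤP.*-identityˡ (𝟙 (k ≟ v))))) (sumF-sift (λ _ → 1ℤ) v)

count-nonneg : {P : Pred (Fin n) p} (P? : Decidable P) → 0ℤ ≤ count P?
count-nonneg {n} P? = subst (_≤ count P?) (sumF-zero n) (sumF-mono-≤ (λ k → 𝟙-nonneg (P? k)))

count≡0⇒∅ : {P : Pred (Fin n) p} (P? : Decidable P) → count P? ≡ 0ℤ → ∀ {k} → ¬ P k
count≡0⇒∅ {n} P? none {k} pk with P? k | sumF-tight (λ k → 𝟙-nonneg (P? k)) (trans (sumF-zero n) (sym none)) k
... | yes _  | ()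
... | no ¬pk | _  = ¬pk pk

count≢0⇒∃ : {P : Pred (Fin n) p} (P? : Decidable P) → count P? ≢ 0ℤ → ∃ P
count≢0⇒∃ P? count≢0 with sumF≢0⇒∃≢0 count≢0
... | k , 𝟙≢0 = k , 𝟙≢0⇒ (P? k) 𝟙≢0

module _ {P : Pred (Fin n) p} {Q : Pred (Fin n) q} (P? : Decidable P) (Q? : Decidable Q) (P⊆Q : P ⊆ Q) where

  count-mono : count P? ≤ count Q?
  count-mono = sumF-mono-≤ (λ k → 𝟙-mono P⊆Q (P? k) (Q? k))

  count-mono-≡ : count P? ≡ count Q? → Q ⊆ P
  count-mono-≡ eq {k} qk with P? k | Q? k | sumF-tight (λ k → 𝟙-mono P⊆Q (P? k) (Q? k)) eq k
  ... | yes pk | _      | _  = pk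
  ... | no _   | yes _  | ()
  ... | no _   | no ¬qk | _  = ⊥-elim (¬qk qk)

  count-mono-≢ : count P? ≢ count Q? → ∃ λ k → Q k × ¬ P k
  count-mono-≢ count≢ with sumF≢0⇒∃≢0 {f = λ k → 𝟙 (Q? k) - 𝟙 (P? k)}
                             (λ eq → count≢ (sym (ℤP.i-j≡0⇒i≡j _ _ (trans (sym difference) eq))))
    where
    difference : sumF (λ k → 𝟙 (Q? k) - 𝟙 (P? k)) ≡ count Q? - count P?
    difference = sumF-distrib-- (λ k → 𝟙 (Q? k)) (λ k → 𝟙 (P? k))
  ... | k , diff≢0 with P? k | Q? k
  ...   | yes _  | yes _  = ⊥-elim (diff≢0 refl)
  ...   | yes pk | no ¬qk = ⊥-elim (¬qk (P⊆Q pk))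
  ...   | no ¬pk | yes qk = k , qk , ¬pk
  ...   | no _   | no _   = ⊥-elim (diff≢0 refl)

count-insert : {P : Pred (Fin n) p} (P? : Decidable P) {v : Fin n} → ¬ P v →
               count ((_≟ v) ∪? P?) ≡ 1ℤ + count P?
count-insert P? {v} ¬pv = begin
  count ((_≟ v) ∪? P?)                    ≡⟨ sumF-cong split ⟩
  sumF (λ k → 𝟙 (k ≟ v) + 𝟙 (P? k))       ≡⟨ sumF-distrib-+ (λ k → 𝟙 (k ≟ v)) (λ k → 𝟙 (P? k)) ⟩
  count (_≟ v) + count P?                 ≡⟨ cong (_+ count P?) (count-≟ v) ⟩
  1ℤ + count P?                           ∎
  where
  open ≡-Reasoning
  split : ∀ k → 𝟙 ((k ≟ v) ⊎-dec P? k) ≡ 𝟙 (k ≟ v) + 𝟙 (P? k)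
  split k with k ≟ v | P? k
  ... | yes refl | yes pv = ⊥-elim (¬pv pv)
  ... | yes _    | no _   = refl
  ... | no _     | yes _  = refl
  ... | no _     | no _   = refl

member? : (L : List (Fin n)) → Decidable (_∈ L)
member? L k = any? (k ≟_) L

count-member? : {L : List (Fin n)} → Unique L → count (member? L) ≡ + length L
count-member? {n} {L = []} _               = sumF-zero n
count-member? {L = x ∷ xs} (x∉ ∷ unique) = begin
  count ((_≟ x) ∪? member? xs)   ≡⟨ count-insert (member? xs) (Unique[x∷xs]⇒x∉xs (x∉ ∷ unique)) ⟩
  1ℤ + count (member? xs)        ≡⟨ cong (_+_ 1ℤ) (count-member? unique) ⟩
  + length (x ∷ xs)              ∎
  where open ≡-Reasoning

module _ {P : Pred (Fin n) p} (P? : Decidable P) {L : List (Fin n)} (unique : Unique L) (all : All P L) where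

  length≤count : + length L ≤ count P?
  length≤count = subst (_≤ count P?) (count-member? unique) (count-mono (member? L) P? (All.lookup all))

  count≡length⇒⊆ : count P? ≡ + length L → P ⊆ (_∈ L)
  count≡length⇒⊆ eq = count-mono-≡ (member? L) P? (All.lookup all) (trans (count-member? unique) (sym eq))

  count≢length⇒∃∉ : count P? ≢ + length L → ∃ λ k → P k × k ∉ L
  count≢length⇒∃∉ count≢ =
    count-mono-≢ (member? L) P? (All.lookup all) (λ eq → count≢ (sym (trans (sym (count-member? unique)) eq)))

module _ {P : Pred (Fin n) p} {Q : Pred (Fin n) q} (P? : Decidable P) (Q? : Decidable Q) where

  count-∩-≤ : count (P? ∩? Q?) ≤ count P?
  count-∩-≤ = count-mono (P? ∩? Q?) P? proj₁

  count-∩-≡⇒⊆ : count (P? ∩? Q?) ≡ count P? → P ⊆ Q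
  count-∩-≡⇒⊆ eq pk = proj₂ (count-mono-≡ (P? ∩? Q?) P? proj₁ eq pk)

  module _ {v : Fin n} (pv : P v) (¬qv : ¬ Q v) where

    private
      v∪P∩Q⊆P : (_≡ v) ∪ (P ∩ Q) ⊆ P
      v∪P∩Q⊆P (inj₁ refl)      = pv
      v∪P∩Q⊆P (inj₂ (pk , _)) = pk

      count-v∪P∩Q : count ((_≟ v) ∪? (P? ∩? Q?)) ≡ 1ℤ + count (P? ∩? Q?)
      count-v∪P∩Q = count-insert (P? ∩? Q?) (λ pqv → ¬qv (proj₂ pqv))

    1+count-∩-≤ : 1ℤ + count (P? ∩? Q?) ≤ count P?
    1+count-∩-≤ = subst (_≤ count P?) count-v∪P∩Q (count-mono ((_≟ v) ∪? (P? ∩? Q?)) P? v∪P∩Q⊆P)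

    1+count-∩-≡⇒⊆ : 1ℤ + count (P? ∩? Q?) ≡ count P? → ∀ {k} → P k → k ≢ v → Q k
    1+count-∩-≡⇒⊆ eq pk k≢v with count-mono-≡ ((_≟ v) ∪? (P? ∩? Q?)) P? v∪P∩Q⊆P (trans count-v∪P∩Q eq) pk
    ... | inj₁ k≡v      = ⊥-elim (k≢v k≡v)
    ... | inj₂ (_ , qk) = qk

count-∩-overlap : {P R S : Pred (Fin n) p} (P? : Decidable P) (R? : Decidable R) (S? : Decidable S) →
                  count P? ℤ.< count (P? ∩? R?) + count (P? ∩? S?) → ∃ (P ∩ R ∩ S)
count-∩-overlap P? R? S? overfull = count≢0⇒∃ (P? ∩? R? ∩? S?) (λ none → ℤP.<⇒≱ overfull (bound none))
  where
  pointwise : ∀ k → 𝟙 ((P? ∩? R?) k) + 𝟙 ((P? ∩? S?) k) ≤ 𝟙 (P? k) + 𝟙 ((P? ∩? R? ∩? S?) k)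
  pointwise k with P? k | R? k | S? k
  ... | yes _ | yes _ | yes _ = ℤP.≤-refl
  ... | yes _ | yes _ | no _  = ℤP.≤-refl
  ... | yes _ | no _  | yes _ = ℤP.≤-refl
  ... | yes _ | no _  | no _  = ℤ.+≤+ ℕ.z≤n
  ... | no _  | _     | _     = ℤP.≤-refl
  bound : count (P? ∩? R? ∩? S?) ≡ 0ℤ → count (P? ∩? R?) + count (P? ∩? S?) ≤ count P?
  bound none = begin
    count (P? ∩? R?) + count (P? ∩? S?)
      ≡⟨ sumF-distrib-+ (λ k → 𝟙 ((P? ∩? R?) k)) (λ k → 𝟙 ((P? ∩? S?) k)) ⟨
    sumF (λ k → 𝟙 ((P? ∩? R?) k) + 𝟙 ((P? ∩? S?) k))
      ≤⟨ sumF-mono-≤ pointwise ⟩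
    sumF (λ k → 𝟙 (P? k) + 𝟙 ((P? ∩? R? ∩? S?) k))
      ≡⟨ sumF-distrib-+ (λ k → 𝟙 (P? k)) (λ k → 𝟙 ((P? ∩? R? ∩? S?) k)) ⟩
    count P? + count (P? ∩? R? ∩? S?)
      ≡⟨ cong (_+_ (count P?)) none ⟩
    count P? + 0ℤ
      ≡⟨ ℤP.+-identityʳ (count P?) ⟩
    count P?
      ∎
    where open ℤP.≤-Reasoning

unique-snoc : {xs : List (Fin n)} {z : Fin n} → Unique xs → z ∉ xs → Unique (xs ++ z ∷ [])
unique-snoc unique z∉ = ++⁺ unique ([] ∷ []) λ { (v∈ , here refl) → z∉ v∈ }

last-of-four : ∀ {A : Set} {w a b c d : A} → w ∈ a ∷ b ∷ c ∷ d ∷ [] → w ≢ a → w ≢ b → w ≢ c → w ≡ d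
last-of-four (here w≡a)                         w≢a _   _   = ⊥-elim (w≢a w≡a)
last-of-four (there (here w≡b))                 _   w≢b _   = ⊥-elim (w≢b w≡b)
last-of-four (there (there (here w≡c)))         _   _   w≢c = ⊥-elim (w≢c w≡c)
last-of-four (there (there (there (here w≡d)))) _   _   _   = w≡d

SignedEntry : ℤ → Set
SignedEntry x = x ≡ 0ℤ ⊎ x ≡ 1ℤ ⊎ x ≡ -1ℤ

module _ {x y : ℤ} where

  private
    ⟦_,_⟧ : ℤ → ℤ → ℤ
    ⟦ σ , τ ⟧ = 𝟙 ((x ℤ.≟ σ) ×-dec (y ℤ.≟ τ))

  entry-product : SignedEntry x → SignedEntry y →
                  x * y ≡ ⟦ 1ℤ , 1ℤ ⟧ + ⟦ -1ℤ , -1ℤ ⟧ - ⟦ 1ℤ , -1ℤ ⟧ - ⟦ -1ℤ , 1ℤ ⟧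
  entry-product (inj₁ refl)        (inj₁ refl)        = refl
  entry-product (inj₁ refl)        (inj₂ (inj₁ refl)) = refl
  entry-product (inj₁ refl)        (inj₂ (inj₂ refl)) = refl
  entry-product (inj₂ (inj₁ refl)) (inj₁ refl)        = refl
  entry-product (inj₂ (inj₁ refl)) (inj₂ (inj₁ refl)) = refl
  entry-product (inj₂ (inj₁ refl)) (inj₂ (inj₂ refl)) = refl
  entry-product (inj₂ (inj₂ refl)) (inj₁ refl)        = refl
  entry-product (inj₂ (inj₂ refl)) (inj₂ (inj₁ refl)) = refl
  entry-product (inj₂ (inj₂ refl)) (inj₂ (inj₂ refl)) = refl

  entry-support-product : SignedEntry x → SignedEntry y →
                          𝟙 (¬? (x ℤ.≟ 0ℤ) ×-dec ¬? (y ℤ.≟ 0ℤ))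
                            ≡ ⟦ 1ℤ , 1ℤ ⟧ + ⟦ -1ℤ , -1ℤ ⟧ + ⟦ 1ℤ , -1ℤ ⟧ + ⟦ -1ℤ , 1ℤ ⟧
  entry-support-product (inj₁ refl)        (inj₁ refl)        = refl
  entry-support-product (inj₁ refl)        (inj₂ (inj₁ refl)) = refl
  entry-support-product (inj₁ refl)        (inj₂ (inj₂ refl)) = refl
  entry-support-product (inj₂ (inj₁ refl)) (inj₁ refl)        = refl
  entry-support-product (inj₂ (inj₁ refl)) (inj₂ (inj₁ refl)) = refl
  entry-support-product (inj₂ (inj₁ refl)) (inj₂ (inj₂ refl)) = refl
  entry-support-product (inj₂ (inj₂ refl)) (inj₁ refl)        = refl
  entry-support-product (inj₂ (inj₂ refl)) (inj₂ (inj₁ refl)) = refl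
  entry-support-product (inj₂ (inj₂ refl)) (inj₂ (inj₂ refl)) = refl

entry-times-𝟙 : ∀ {x p} {P : Set p} → SignedEntry x → (P? : Dec P) →
                x * 𝟙 P? ≡ 𝟙 ((x ℤ.≟ 1ℤ) ×-dec P?) - 𝟙 ((x ℤ.≟ -1ℤ) ×-dec P?)
entry-times-𝟙 (inj₁ refl)        (yes _) = refl
entry-times-𝟙 (inj₁ refl)        (no _)  = refl
entry-times-𝟙 (inj₂ (inj₁ refl)) (yes _) = refl
entry-times-𝟙 (inj₂ (inj₁ refl)) (no _)  = refl
entry-times-𝟙 (inj₂ (inj₂ refl)) (yes _) = refl
entry-times-𝟙 (inj₂ (inj₂ refl)) (no _)  = refl

entry-signs : ∀ {x} → SignedEntry x → x ≡ 𝟙 (x ℤ.≟ 1ℤ) - 𝟙 (x ℤ.≟ -1ℤ)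
entry-signs (inj₁ refl)        = refl
entry-signs (inj₂ (inj₁ refl)) = refl
entry-signs (inj₂ (inj₂ refl)) = refl

entry-support : ∀ {x} → SignedEntry x → 𝟙 (¬? (x ℤ.≟ 0ℤ)) ≡ 𝟙 (x ℤ.≟ 1ℤ) + 𝟙 (x ℤ.≟ -1ℤ)
entry-support (inj₁ refl)        = refl
entry-support (inj₂ (inj₁ refl)) = refl
entry-support (inj₂ (inj₂ refl)) = refl

-1≢0 : -1ℤ ≢ 0ℤ
-1≢0 ()

◃1≢0 : ∀ s → s ◃ 1 ≢ 0ℤ
◃1≢0 Sign.+ ()
◃1≢0 Sign.- ()

M·M²≡M²·M : (M : SMat n) (u v : Fin n) → sumF (λ w → M u w * sq M w v) ≡ sumF (λ w → sq M u w * M w v)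
M·M²≡M²·M M u v = begin
  sumF (λ w → M u w * sumF (λ k → M w k * M k v))
    ≡⟨ sumF-cong (λ w → sym (*-distribˡ-sumF (M u w) (λ k → M w k * M k v))) ⟩
  sumF (λ w → sumF (λ k → M u w * (M w k * M k v)))
    ≡⟨ sumF-comm (λ w k → M u w * (M w k * M k v)) ⟩
  sumF (λ k → sumF (λ w → M u w * (M w k * M k v)))
    ≡⟨ sumF-cong (λ k → sumF-cong (λ w → sym (ℤP.*-assoc (M u w) (M w k) (M k v)))) ⟩
  sumF (λ k → sumF (λ w → M u w * M w k * M k v))
    ≡⟨ sumF-cong (λ k → *-distribʳ-sumF (M k v) (λ w → M u w * M w k)) ⟩
  sumF (λ k → sq M u k * M k v)
    ∎
  where open ≡-Reasoning

transitive-adjacency⇒complete : {A : SMat n} →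
  (∀ {s t k} → A s t ≢ 0ℤ → A t k ≢ 0ℤ → s ≢ k → A s k ≢ 0ℤ) → Connected A → Complete A
transitive-adjacency⇒complete {A = A} adj-trans connected s k = along (connected s k)
  where
  along : ∀ {s k} → Reach A s k → s ≢ k → A s k ≢ 0ℤ
  along here                      s≢s = ⊥-elim (s≢s refl)
  along (step {j = j} {k} s~j walk) s≢k with j ≟ k
  ... | yes refl = s~j
  ... | no j≢k   = adj-trans s~j (along walk j≢k) s≢k

reach-closed : {A : SMat n} {P : Pred (Fin n) p} → (∀ {j k} → P j → A j k ≢ 0ℤ → P k) →
               ∀ {i k} → Reach A i k → P i → P k
reach-closed closed here             pi = pi
reach-closed closed (step i~j walk) pi = reach-closed closed walk (closed pi i~j)

embedding⇒Iso : ∀ {m} {A : SMat n} {B : SMat m} (g : Fin m → Fin n) → (∀ s t → A (g s) (g t) ≡ B s t) →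
                (∀ {s t} → g s ≡ g t → s ≡ t) → (∀ k → ∃ λ s → g s ≡ k) → Iso A B
embedding⇒Iso {A = A} g g-edges g-injective g-onto =
  bijection , λ i j → trans (sym (g-edges (g⁻¹ i) (g⁻¹ j))) (cong₂ A (proj₂ (g-onto i)) (proj₂ (g-onto j)))
  where
  g⁻¹ : Fin _ → Fin _
  g⁻¹ k = proj₁ (g-onto k)
  bijection : Fin _ ↔ Fin _
  bijection = record
    { to        = g⁻¹
    ; from      = g
    ; to-cong   = cong g⁻¹
    ; from-cong = cong g
    ; inverse   = (λ {s} {k} k≡gs → g-injective (trans (proj₂ (g-onto k)) k≡gs))
                , (λ {k} {s} s≡g⁻¹k → trans (cong g s≡g⁻¹k) (proj₂ (g-onto k)))
    }

some-vertex : {A : SMat n} → ¬ Edgeless A → Fin n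
some-vertex {zero}  not-edgeless = ⊥-elim (not-edgeless λ ())
some-vertex {suc n} _            = zero

c≡0⊎κ≢0 : {A : SMat n} {a b c : ℤ} → C₁ A a b c ⊎ C₄ A a b c ⊎ C₅ A a b c → ¬ Complete A →
           c ≡ 0ℤ ⊎ a + b - + 2 * c ≢ 0ℤ
c≡0⊎κ≢0 (inj₁ (_ , _ , inj₁ complete))       ¬complete = ⊥-elim (¬complete complete)
c≡0⊎κ≢0 {a = a} {b} {c} (inj₁ (_ , a≡-b , inj₂ (_ , c≢0))) _ = inj₂ (λ κ≡0 → c≢0 (c≡0 κ≡0))
  where
  κ-as : ∀ b c → - b + b - + 2 * c ≡ - + 2 * c
  κ-as = solve-∀
  c≡0 : a + b - + 2 * c ≡ 0ℤ → c ≡ 0ℤ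
  c≡0 κ≡0 with ℤP.i*j≡0⇒i≡0∨j≡0 (- + 2) (trans (sym (κ-as b c)) (subst (λ a → a + b - + 2 * c ≡ 0ℤ) a≡-b κ≡0))
  ... | inj₂ c≡0 = c≡0
c≡0⊎κ≢0 (inj₂ (inj₁ (_ , _ , _ , c≡0)))        _ = inj₁ c≡0
c≡0⊎κ≢0 (inj₂ (inj₂ (_ , _ , _ , 2c≢a+b , _))) _ = inj₂ (λ κ≡0 → 2c≢a+b (sym (ℤP.i-j≡0⇒i≡j _ _ κ≡0)))

Bounded : ℕ → ℤ → Set
Bounded m x = 0ℤ ≤ x × x ≤ + m

split-6-2 : ∀ {x y} → x + y ≡ + 6 → x - y ≡ + 2 → x ≡ + 4 × y ≡ + 2
split-6-2 {x} {y} sum diff = x≡4 , y≡2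
  where
  twice-y : ∀ x y → + 2 * y ≡ x + y - (x - y)
  twice-y = solve-∀
  y≡2 : y ≡ + 2
  y≡2 = ℤP.*-cancelˡ-≡ (+ 2) y (+ 2) (trans (twice-y x y) (cong₂ _-_ sum diff))
  x-as : ∀ x y → x ≡ x - y + y
  x-as = solve-∀
  x≡4 : x ≡ + 4
  x≡4 = trans (x-as x y) (cong₂ _+_ diff y≡2)

deg : Sign → ℕ
deg Sign.+ = 4
deg Sign.- = 2

-- p, q, r, s stand for w⁺⁺, w⁻⁻, w⁺⁻, w⁻⁺ at a pair of vertices: p + q − r − s is the entry of A²
-- and p + q + r + s the number of common neighbours. The walk counts lie in this box, so each fact
-- below is checked by evaluation at its 5 · 3 · 5 · 3 points.
Box : ℤ → ℤ → ℤ → ℤ → Set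
Box p q r s = Bounded 4 p × Bounded 2 q × Bounded 4 r × Bounded 2 s

module _ {R : ℤ → ℤ → ℤ → ℤ → Set} (R? : ∀ p q r s → Dec (R p q r s)) where

  private
    as-Fin : ∀ {m x} → Bounded m x → ∃ λ (i : Fin (suc m)) → x ≡ + toℕ i
    as-Fin (ℤ.+≤+ _ , ℤ.+≤+ k≤m) = Fin.fromℕ< (ℕ.s≤s k≤m) , cong +_ (sym (FinP.toℕ-fromℕ< _))

  decide-on-box : True (FinP.all? λ (i : Fin 5) → FinP.all? λ (j : Fin 3) → FinP.all? λ (k : Fin 5) → FinP.all? λ (l : Fin 3) →
                          R? (+ toℕ i) (+ toℕ j) (+ toℕ k) (+ toℕ l)) →
                  ∀ {p q r s} → Box p q r s → R p q r s
  decide-on-box checked (bp , bq , br , bs) with as-Fin bp | as-Fin bq | as-Fin br | as-Fin bs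
  ... | i , refl | j , refl | k , refl | l , refl = toWitness checked i j k l

b≡5-profile : ∀ {p q r s} → Box p q r s →
  p + q - r - s ≡ + 5 → 1ℤ + (p + q + r + s) ≤ + 6 → 1ℤ + q ≤ + 2 → p ≡ + 4 × q ≡ 1ℤ
b≡5-profile = decide-on-box (λ p q r s →
  (p + q - r - s ℤ.≟ + 5) →-dec (1ℤ + (p + q + r + s) ℤ.≤? + 6) →-dec (1ℤ + q ℤ.≤? + 2) →-dec
  (p ℤ.≟ + 4) ×-dec (q ℤ.≟ 1ℤ)) _

a≡-3-profile : ∀ {p q r s} → Box p q r s →
  r ≡ s → p + q - r - s ≡ - + 3 → 1ℤ + (p + q + r + s) ≤ + 6 → 1ℤ + (p + q + r + s) ≡ + 6 × s ≡ + 2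
a≡-3-profile = decide-on-box (λ p q r s →
  (r ℤ.≟ s) →-dec (p + q - r - s ℤ.≟ - + 3) →-dec (1ℤ + (p + q + r + s) ℤ.≤? + 6) →-dec
  (1ℤ + (p + q + r + s) ℤ.≟ + 6) ×-dec (s ℤ.≟ + 2)) _

a≡-4-profile : ∀ {p q r s} → Box p q r s →
  r ≡ s → p + q - r - s ≡ - + 4 → 1ℤ + (p + q + r + s) ≤ + 6 → p ≡ 0ℤ × s ≡ + 2
a≡-4-profile = decide-on-box (λ p q r s →
  (r ℤ.≟ s) →-dec (p + q - r - s ℤ.≟ - + 4) →-dec (1ℤ + (p + q + r + s) ℤ.≤? + 6) →-dec
  (p ℤ.≟ 0ℤ) ×-dec (s ℤ.≟ + 2)) _

b≡4-profile : ∀ {p q r s} → Box p q r s →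
  r ≡ s → p + q - r - s ≡ + 4 → 1ℤ + q ≤ + 2 → + 3 ≤ p
b≡4-profile = decide-on-box (λ p q r s →
  (r ℤ.≟ s) →-dec (p + q - r - s ℤ.≟ + 4) →-dec (1ℤ + q ℤ.≤? + 2) →-dec (+ 3 ℤ.≤? p)) _

s≡2-profile : ∀ {p q r s} → Box p q r s →
  r ≡ s → + 2 ≤ s → 1ℤ + (p + q + r + s) ≤ + 6 → p + q - r - s ≡ - + 4 ⊎ p + q - r - s ≡ - + 3
s≡2-profile = decide-on-box (λ p q r s →
  (r ℤ.≟ s) →-dec (+ 2 ℤ.≤? s) →-dec (1ℤ + (p + q + r + s) ℤ.≤? + 6) →-dec
  ((p + q - r - s ℤ.≟ - + 4) ⊎-dec (p + q - r - s ℤ.≟ - + 3))) _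

p≡4-profile : ∀ {p q r s} → Box p q r s →
  p ≡ + 4 → 1ℤ ≤ q → 1ℤ + (p + q + r + s) ≤ + 6 → p + q - r - s ≡ + 5
p≡4-profile = decide-on-box (λ p q r s →
  (p ℤ.≟ + 4) →-dec (1ℤ ℤ.≤? q) →-dec (1ℤ + (p + q + r + s) ℤ.≤? + 6) →-dec (p + q - r - s ℤ.≟ + 5)) _

profile≢7 : ∀ {p q r s} → Box p q r s → 1ℤ + (p + q + r + s) ≤ + 6 → p + q - r - s ≢ + 7
profile≢7 = decide-on-box (λ p q r s →
  (1ℤ + (p + q + r + s) ℤ.≤? + 6) →-dec ¬? (p + q - r - s ℤ.≟ + 7)) _

4*profile≢-10 : ∀ {p q r s} → Box p q r s → + 4 * (p + q - r - s) ≢ - + 10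
4*profile≢-10 = decide-on-box (λ p q r s → ¬? (+ 4 * (p + q - r - s) ℤ.≟ - + 10)) _

pattern 0F = zero
pattern 1F = suc 0F
pattern 2F = suc 1F
pattern 3F = suc 2F
pattern 4F = suc 3F
pattern 5F = suc 4F
pattern 6F = suc 5F
pattern 7F = suc 6F

-- the partner of a vertex in the perfect matching removed from K₈
twin : Fin 8 → Fin 8
twin 0F = 7F
twin 1F = 6F
twin 2F = 3F
twin 3F = 2F
twin 4F = 5F
twin 5F = 4F
twin 6F = 1F
twin 7F = 0F

S²₈-non-adjacent⇒twins : ∀ s t → S²₈ s t ≡ 0ℤ → s ≡ t ⊎ t ≡ twin s
S²₈-non-adjacent⇒twins = toWitness {a? = FinP.all? λ s → FinP.all? λ t →
  (S²₈ s t ℤ.≟ 0ℤ) →-dec ((s ≟ t) ⊎-dec (t ≟ twin s))} _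

S²₈-neighbours : Sign → Fin 8 → List (Fin 8)
S²₈-neighbours σ s = filter (λ t → S²₈ s t ℤ.≟ σ ◃ 1) (allFin 8)

S²₈-degree : ∀ σ s → length (S²₈-neighbours σ s) ≡ deg σ
S²₈-degree Sign.+ = toWitness {a? = FinP.all? λ s → length (S²₈-neighbours Sign.+ s) ℕ.≟ 4} _
S²₈-degree Sign.- = toWitness {a? = FinP.all? λ s → length (S²₈-neighbours Sign.- s) ℕ.≟ 2} _

S²₈-srsg : IsSRSG S²₈ 6 (- (+ 4)) (+ 4) (+ 6)
S²₈-srsg = record
  { notHomComplete = λ (_ , complete) → complete 7F 0F (λ ()) refl
  ; notEdgeless    = λ edgeless → case edgeless 0F 1F of λ ()
  ; diag = toWitness {a? = FinP.all? λ i → sq S²₈ i i ℤ.≟ + 6} _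
  ; pos  = toWitness {a? = FinP.all? λ i → FinP.all? λ j → (S²₈ i j ℤ.≟ 1ℤ) →-dec (sq S²₈ i j ℤ.≟ - + 4)} _
  ; neg  = toWitness {a? = FinP.all? λ i → FinP.all? λ j → (S²₈ i j ℤ.≟ -1ℤ) →-dec (sq S²₈ i j ℤ.≟ + 4)} _
  ; non  = λ i j i≢j ij≡0 → [ ⊥-elim ∘ i≢j , id ]′ (toWitness {a? = FinP.all? λ i → FinP.all? λ j →
             (S²₈ i j ℤ.≟ 0ℤ) →-dec ((i ≟ j) ⊎-dec (sq S²₈ i j ℤ.≟ + 6))} _ i j ij≡0)
  }

module SignedGraph {n : ℕ} (A : SMat n) (G : IsSignedGraph A) where

  open IsSignedGraph G public

  sign? : (s : Sign) (u : Fin n) → Decidable (λ w → A u w ≡ s ◃ 1)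
  sign? s u w = A u w ℤ.≟ s ◃ 1

  signTo? : (t : Sign) (v : Fin n) → Decidable (λ w → A w v ≡ t ◃ 1)
  signTo? t v w = A w v ℤ.≟ t ◃ 1

  adj? : (u : Fin n) → Decidable (λ w → A u w ≢ 0ℤ)
  adj? u w = ¬? (A u w ℤ.≟ 0ℤ)

  adjTo? : (v : Fin n) → Decidable (λ w → A w v ≢ 0ℤ)
  adjTo? v w = ¬? (A w v ℤ.≟ 0ℤ)

  walk? : (s t : Sign) (u v : Fin n) → Decidable (λ w → A u w ≡ s ◃ 1 × A w v ≡ t ◃ 1)
  walk? s t u v = sign? s u ∩? signTo? t v

  walks : Sign → Sign → Fin n → Fin n → ℤ
  walks s t u v = count (walk? s t u v)

  w⁺⁺ w⁻⁻ w⁺⁻ w⁻⁺ : Fin n → Fin n → ℤ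
  w⁺⁺ = walks Sign.+ Sign.+
  w⁻⁻ = walks Sign.- Sign.-
  w⁺⁻ = walks Sign.+ Sign.-
  w⁻⁺ = walks Sign.- Sign.+

  common : Fin n → Fin n → ℤ
  common u v = count (adj? u ∩? adjTo? v)

  sq≡walks : ∀ u v → sq A u v ≡ w⁺⁺ u v + w⁻⁻ u v - w⁺⁻ u v - w⁻⁺ u v
  sq≡walks u v = trans (sumF-cong (λ w → entry-product (entries u w) (entries w v)))
                       (sumF-distrib-+-- (𝟙walk Sign.+ Sign.+) (𝟙walk Sign.- Sign.-) (𝟙walk Sign.+ Sign.-) (𝟙walk Sign.- Sign.+))
    where
    𝟙walk : Sign → Sign → Fin n → ℤ
    𝟙walk s t w = 𝟙 (walk? s t u v w)

  common≡walks : ∀ u v → common u v ≡ w⁺⁺ u v + w⁻⁻ u v + w⁺⁻ u v + w⁻⁺ u v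
  common≡walks u v = trans (sumF-cong (λ w → entry-support-product (entries u w) (entries w v)))
                           (sumF-distrib-+++ (𝟙walk Sign.+ Sign.+) (𝟙walk Sign.- Sign.-) (𝟙walk Sign.+ Sign.-) (𝟙walk Sign.- Sign.+))
    where
    𝟙walk : Sign → Sign → Fin n → ℤ
    𝟙walk s t w = 𝟙 (walk? s t u v w)

  walks-transpose : ∀ s t u v → walks s t u v ≡ walks t s v u
  walks-transpose s t u v = sumF-cong (λ w → cong indicator (swap w))
    where
    swap : ∀ w → does (A u w ℤ.≟ s ◃ 1) ∧ does (A w v ℤ.≟ t ◃ 1)
               ≡ does (A v w ℤ.≟ t ◃ 1) ∧ does (A w u ℤ.≟ s ◃ 1)
    swap w rewrite symm v w | symm w u = ∧-comm (does (A u w ℤ.≟ s ◃ 1)) (does (A w v ℤ.≟ t ◃ 1))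

  row-times-𝟙 : ∀ t u v → sumF (λ w → A u w * 𝟙 (signTo? t v w)) ≡ walks Sign.+ t u v - walks Sign.- t u v
  row-times-𝟙 t u v = trans (sumF-cong (λ w → entry-times-𝟙 (entries u w) (signTo? t v w)))
                          (sumF-distrib-- (λ w → 𝟙 (walk? Sign.+ t u v w)) (λ w → 𝟙 (walk? Sign.- t u v w)))

  row-sum : ∀ u → sumF (A u) ≡ count (sign? Sign.+ u) - count (sign? Sign.- u)
  row-sum u = trans (sumF-cong (λ w → entry-signs (entries u w)))
                    (sumF-distrib-- (λ w → 𝟙 (sign? Sign.+ u w)) (λ w → 𝟙 (sign? Sign.- u w)))

  degree≡count-adj : ∀ u → degree A u ≡ count (adj? u)
  degree≡count-adj u = sumF-cong (λ w → cong (indicator ∘ not) (isYes≗does (A u w ℤ.≟ 0ℤ)))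

  count-adj≡ : ∀ u → count (adj? u) ≡ count (sign? Sign.+ u) + count (sign? Sign.- u)
  count-adj≡ u = trans (sumF-cong (λ w → entry-support (entries u w)))
                       (sumF-distrib-+ (λ w → 𝟙 (sign? Sign.+ u w)) (λ w → 𝟙 (sign? Sign.- u w)))

  posDeg≡ : ∀ u → posDeg A u ≡ count (sign? Sign.+ u)
  posDeg≡ u = sumF-cong (λ w → cong indicator (isYes≗does (A u w ℤ.≟ 1ℤ)))

  negDeg≡ : ∀ u → negDeg A u ≡ count (sign? Sign.- u)
  negDeg≡ u = sumF-cong (λ w → cong indicator (isYes≗does (A u w ℤ.≟ -1ℤ)))

  sq-symmetric : ∀ u v → sq A u v ≡ sq A v u
  sq-symmetric u v = sumF-cong (λ k → trans (cong₂ _*_ (symm u k) (symm k v)) (ℤP.*-comm (A k u) (A v k)))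

  edge⁺ : ∀ {s t} → A s t ≡ 1ℤ → A s t ≢ 0ℤ
  edge⁺ st st≡0 = case trans (sym st) st≡0 of λ ()

  edge⁻ : ∀ {s t} → A s t ≡ -1ℤ → A s t ≢ 0ℤ
  edge⁻ st st≡0 = case trans (sym st) st≡0 of λ ()

  flip : ∀ {s t x} → A s t ≡ x → A t s ≡ x
  flip {s} {t} st = trans (symm t s) st

  flip-adj : ∀ {s t} → A s t ≢ 0ℤ → A t s ≢ 0ℤ
  flip-adj s~t ts≡0 = s~t (flip ts≡0)

  adjacent-sign : ∀ {s t} → A s t ≢ 0ℤ → A s t ≡ 1ℤ ⊎ A s t ≡ -1ℤ
  adjacent-sign {s} {t} s~t with entries s t
  ... | inj₁ st≡0 = ⊥-elim (s~t st≡0)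
  ... | inj₂ sign = sign

  distinct-targets : ∀ {z w o i j} → A z w ≡ i → A z o ≡ j → i ≢ j → w ≢ o
  distinct-targets zw zo i≢j refl = i≢j (trans (sym zw) zo)

  neither⇒0 : ∀ {s t} → A s t ≢ 1ℤ → A s t ≢ -1ℤ → A s t ≡ 0ℤ
  neither⇒0 {s} {t} st≢1 st≢-1 with entries s t
  ... | inj₁ st≡0         = st≡0
  ... | inj₂ (inj₁ st≡1)  = ⊥-elim (st≢1 st≡1)
  ... | inj₂ (inj₂ st≡-1) = ⊥-elim (st≢-1 st≡-1)

  adjacent⇒≢ : ∀ {s t} → A s t ≢ 0ℤ → s ≢ t
  adjacent⇒≢ {s} s~t refl = s~t (loopless s)

  module Regular62 (regular : Regular A 6) (net-regular : NetRegular A (+ 2)) where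

    count-sign : ∀ s u → count (sign? s u) ≡ + deg s
    count-sign s u = pick s (split-6-2 total net)
      where
      total : count (sign? Sign.+ u) + count (sign? Sign.- u) ≡ + 6
      total = trans (sym (count-adj≡ u)) (trans (sym (degree≡count-adj u)) (regular u))
      net : count (sign? Sign.+ u) - count (sign? Sign.- u) ≡ + 2
      net = trans (sym (cong₂ _-_ (posDeg≡ u) (negDeg≡ u))) (net-regular u)
      pick : ∀ s → count (sign? Sign.+ u) ≡ + 4 × count (sign? Sign.- u) ≡ + 2 → count (sign? s u) ≡ + deg s
      pick Sign.+ = proj₁
      pick Sign.- = proj₂

    row-sum≡2 : ∀ u → sumF (A u) ≡ + 2
    row-sum≡2 u = trans (row-sum u) (cong₂ _-_ (count-sign Sign.+ u) (count-sign Sign.- u))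

    walks-bounded : ∀ s t u v → Bounded (deg s) (walks s t u v)
    walks-bounded s t u v = count-nonneg (walk? s t u v) , subst (walks s t u v ≤_) (count-sign s u) (count-∩-≤ (sign? s u) (signTo? t v))

    walks≡deg⇒ : ∀ {s t u v w} → walks s t u v ≡ + deg s → A u w ≡ s ◃ 1 → A w v ≡ t ◃ 1
    walks≡deg⇒ {s} {t} {u} {v} full = count-∩-≡⇒⊆ (sign? s u) (signTo? t v) (trans full (sym (count-sign s u)))

    module _ {s t : Sign} {u v : Fin n} (uv : A u v ≡ s ◃ 1) where

      private
        ¬vv : A v v ≢ t ◃ 1
        ¬vv vv = ◃1≢0 t (trans (sym vv) (loopless v))

      1+walks≤deg : 1ℤ + walks s t u v ≤ + deg s
      1+walks≤deg = subst (1ℤ + walks s t u v ≤_) (count-sign s u) (1+count-∩-≤ (sign? s u) (signTo? t v) uv ¬vv)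

      1+walks≡deg⇒ : 1ℤ + walks s t u v ≡ + deg s → ∀ {w} → A u w ≡ s ◃ 1 → w ≢ v → A w v ≡ t ◃ 1
      1+walks≡deg⇒ full = 1+count-∩-≡⇒⊆ (sign? s u) (signTo? t v) uv ¬vv (trans full (sym (count-sign s u)))

    module _ {u v : Fin n} (u~v : A u v ≢ 0ℤ) where

      private
        ¬vv : A v v ≢ 0ℤ → ⊥
        ¬vv v~v = v~v (loopless v)

        count-adj≡6 : count (adj? u) ≡ + 6
        count-adj≡6 = trans (sym (degree≡count-adj u)) (regular u)

      1+common≤6 : 1ℤ + common u v ≤ + 6
      1+common≤6 = subst (1ℤ + common u v ≤_) count-adj≡6 (1+count-∩-≤ (adj? u) (adjTo? v) u~v ¬vv)

      1+common≡6⇒ : 1ℤ + common u v ≡ + 6 → ∀ {w} → A u w ≢ 0ℤ → w ≢ v → A w v ≢ 0ℤ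
      1+common≡6⇒ full = 1+count-∩-≡⇒⊆ (adj? u) (adjTo? v) u~v ¬vv (trans full (sym count-adj≡6))

    module _ (s : Sign) (u : Fin n) {L : List (Fin n)} (unique : Unique L) (all : All (λ w → A u w ≡ s ◃ 1) L) where

      fresh : length L ℕ.< deg s → ∃ λ w → A u w ≡ s ◃ 1 × w ∉ L
      fresh short = count≢length⇒∃∉ (sign? s u) unique all
                      (λ eq → ℕP.<⇒≢ short (ℤP.+-injective (trans (sym eq) (count-sign s u))))

      exhaust : length L ≡ deg s → ∀ {w} → A u w ≡ s ◃ 1 → w ∈ L
      exhaust full = count≡length⇒⊆ (sign? s u) unique all (trans (count-sign s u) (cong +_ (sym full)))

    some-neighbour : ∀ s u → ∃ λ w → A u w ≡ s ◃ 1
    some-neighbour s u = let w , uw , _ = fresh s u [] [] (deg-positive s) in w , uw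
      where
      deg-positive : ∀ s → 0 ℕ.< deg s
      deg-positive Sign.+ = ℕ.s≤s ℕ.z≤n
      deg-positive Sign.- = ℕ.s≤s ℕ.z≤n

    other-negative : ∀ {u x} → A u x ≡ -1ℤ → ∃ λ y → A u y ≡ -1ℤ × y ≢ x
    other-negative {u} {x} ux =
      let y , uy , y∉ = fresh Sign.- u ([] ∷ []) (ux ∷ []) ℕP.≤-refl in y , uy , λ y≡x → y∉ (here y≡x)

    negative-pair : ∀ u → ∃₂ λ x y → A u x ≡ -1ℤ × A u y ≡ -1ℤ × x ≢ y
    negative-pair u =
      let x , ux = some-neighbour Sign.- u
          y , uy , y≢x = other-negative ux
      in x , y , ux , uy , λ x≡y → y≢x (sym x≡y)

    only-negatives : ∀ {u x y z} → A u x ≡ -1ℤ → A u y ≡ -1ℤ → x ≢ y → A u z ≡ -1ℤ → z ≡ x ⊎ z ≡ y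
    only-negatives {u} ux uy x≢y uz with exhaust Sign.- u ((x≢y ∷ []) ∷ [] ∷ []) (ux ∷ uy ∷ []) refl uz
    ... | here z≡x         = inj₁ z≡x
    ... | there (here z≡y) = inj₂ z≡y

    walks≡0⇒ : ∀ {s t u v w} → walks s t u v ≡ 0ℤ → A u w ≡ s ◃ 1 → A w v ≢ t ◃ 1
    walks≡0⇒ {s} {t} {u} {v} none uw wv = count≡0⇒∅ (walk? s t u v) none (uw , wv)

    profile : ∀ u v → Box (w⁺⁺ u v) (w⁻⁻ u v) (w⁺⁻ u v) (w⁻⁺ u v)
    profile u v = walks-bounded Sign.+ Sign.+ u v , walks-bounded Sign.- Sign.- u v
                , walks-bounded Sign.+ Sign.- u v , walks-bounded Sign.- Sign.+ u v

    1+walks≤6 : ∀ {u v} → A u v ≢ 0ℤ → 1ℤ + (w⁺⁺ u v + w⁻⁻ u v + w⁺⁻ u v + w⁻⁺ u v) ≤ + 6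
    1+walks≤6 {u} {v} u~v = subst (λ x → 1ℤ + x ≤ + 6) (common≡walks u v) (1+common≤6 u~v)

    row-sum-sq : ∀ u → sumF (sq A u) ≡ + 4
    row-sum-sq u = begin
      sumF (λ v → sumF (λ k → A u k * A k v))  ≡⟨ sumF-comm (λ v k → A u k * A k v) ⟩
      sumF (λ k → sumF (λ v → A u k * A k v))  ≡⟨ sumF-cong (λ k → trans (*-distribˡ-sumF (A u k) (A k))
                                                                         (cong (A u k *_) (row-sum≡2 k))) ⟩
      sumF (λ k → A u k * + 2)                 ≡⟨ *-distribʳ-sumF (+ 2) (A u) ⟩
      sumF (A u) * + 2                         ≡⟨ cong (_* + 2) (row-sum≡2 u) ⟩
      + 4                                      ∎
      where open ≡-Reasoning

    negative-triangle-closed : ∀ {p x y w z} → A p x ≡ -1ℤ → A p y ≡ -1ℤ → A x y ≡ -1ℤ →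
                               w ∈ p ∷ x ∷ y ∷ [] → A w z ≡ -1ℤ → z ∈ p ∷ x ∷ y ∷ []
    negative-triangle-closed px py xy (here refl) pz =
      [ there ∘ here , there ∘ there ∘ here ]′ (only-negatives px py (adjacent⇒≢ (edge⁻ xy)) pz)
    negative-triangle-closed px py xy (there (here refl)) xz =
      [ here , there ∘ there ∘ here ]′ (only-negatives (flip px) xy (adjacent⇒≢ (edge⁻ py)) xz)
    negative-triangle-closed px py xy (there (there (here refl))) yz =
      [ here , there ∘ here ]′ (only-negatives (flip py) (flip xy) (adjacent⇒≢ (edge⁻ px)) yz)

    -- A negative triangle is closed under negative edges, so a fourth positive neighbour z of u
    -- cannot send its negative edges into u's positive neighbourhood, which the four of them fill.
    triangle-in-positive-neighbourhood⊥ : ∀ {u p x y z} → Unique (p ∷ x ∷ y ∷ []) → z ∉ p ∷ x ∷ y ∷ [] →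
      All (λ w → A u w ≡ 1ℤ) (p ∷ x ∷ y ∷ z ∷ []) → A p x ≡ -1ℤ → A p y ≡ -1ℤ → A x y ≡ -1ℤ →
      (∀ {w} → A z w ≡ -1ℤ → A u w ≡ 1ℤ) → ⊥
    triangle-in-positive-neighbourhood⊥ {u} {p} {x} {y} {z} unique z∉ all px py xy escape =
      trapped (proj₂ (some-neighbour Sign.- z))
      where
      trapped : ∀ {w} → A z w ≡ -1ℤ → ⊥
      trapped zw with exhaust Sign.+ u (unique-snoc unique z∉) all refl (escape zw)
      ... | there (there (there (here refl))) = edge⁻ zw (loopless z)
      ... | here w≡p                          = z∉ (negative-triangle-closed px py xy (here w≡p) (flip zw))
      ... | there (here w≡x)                  = z∉ (negative-triangle-closed px py xy (there (here w≡x)) (flip zw))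
      ... | there (there (here w≡y))          = z∉ (negative-triangle-closed px py xy (there (there (here w≡y))) (flip zw))

module StronglyRegular62 {n : ℕ} (A : SMat n) (G : IsSignedGraph A)
                         (regular : Regular A 6) (net-regular : NetRegular A (+ 2))
                         {a b c : ℤ} (srsg : IsSRSG A 6 a b c) where

  open SignedGraph A G
  open Regular62 regular net-regular

  open IsSRSG srsg

  κ : ℤ
  κ = a + b - + 2 * c

  sq-affine : ∀ w v → sq A w v ≡ (+ 6 - c) * 𝟙 (w ≟ v) + (a - c) * 𝟙 (signTo? Sign.+ v w)
                                   + (b - c) * 𝟙 (signTo? Sign.- v w) + c
  sq-affine w v with w ≟ v | entries w v
  ... | yes refl | _                  rewrite loopless w = trans (diag w) (on-diagonal a b c)
    where
    on-diagonal : ∀ a b c → + 6 ≡ (+ 6 - c) * 1ℤ + (a - c) * 0ℤ + (b - c) * 0ℤ + c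
    on-diagonal = solve-∀
  ... | no w≢v   | inj₁ wv≡0          rewrite wv≡0 = trans (non w v w≢v wv≡0) (off-edge a b c)
    where
    off-edge : ∀ a b c → c ≡ (+ 6 - c) * 0ℤ + (a - c) * 0ℤ + (b - c) * 0ℤ + c
    off-edge = solve-∀
  ... | no _     | inj₂ (inj₁ wv≡1)  rewrite wv≡1 = trans (pos w v wv≡1) (on-positive a b c)
    where
    on-positive : ∀ a b c → a ≡ (+ 6 - c) * 0ℤ + (a - c) * 1ℤ + (b - c) * 0ℤ + c
    on-positive = solve-∀
  ... | no _     | inj₂ (inj₂ wv≡-1) rewrite wv≡-1 = trans (neg w v wv≡-1) (on-negative a b c)
    where
    on-negative : ∀ a b c → b ≡ (+ 6 - c) * 0ℤ + (a - c) * 0ℤ + (b - c) * 1ℤ + c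
    on-negative = solve-∀

  cube : Fin n → Fin n → ℤ
  cube u v = sumF (λ w → A u w * sq A w v)

  cube-expansion : ∀ u v → cube u v ≡ (+ 6 - c) * A u v + (a - c) * (w⁺⁺ u v - w⁻⁺ u v)
                                        + (b - c) * (w⁺⁻ u v - w⁻⁻ u v) + c * + 2
  cube-expansion u v = begin
    sumF (λ w → A u w * sq A w v)
      ≡⟨ sumF-cong (λ w → cong (A u w *_) (sq-affine w v)) ⟩
    sumF (λ w → A u w * ((+ 6 - c) * δ w + (a - c) * P w + (b - c) * N w + c))
      ≡⟨ sumF-affine (A u) δ P N (+ 6 - c) (a - c) (b - c) c ⟩
    (+ 6 - c) * sumF (λ w → A u w * δ w) + (a - c) * sumF (λ w → A u w * P w)
      + (b - c) * sumF (λ w → A u w * N w) + c * sumF (A u)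
      ≡⟨ cong₂ _+_ (cong₂ _+_ (cong₂ _+_ (cong ((+ 6 - c) *_) (sumF-sift (A u) v))
                                         (cong ((a - c) *_) (row-times-𝟙 Sign.+ u v)))
                              (cong ((b - c) *_) (row-times-𝟙 Sign.- u v)))
                   (cong (c *_) (row-sum≡2 u)) ⟩
    (+ 6 - c) * A u v + (a - c) * (w⁺⁺ u v - w⁻⁺ u v) + (b - c) * (w⁺⁻ u v - w⁻⁻ u v) + c * + 2
      ∎
    where
    open ≡-Reasoning
    δ P N : Fin n → ℤ
    δ w = 𝟙 (w ≟ v)
    P w = 𝟙 (signTo? Sign.+ v w)
    N w = 𝟙 (signTo? Sign.- v w)

  cube-symmetric : ∀ u v → cube u v ≡ cube v u
  cube-symmetric u v = trans (M·M²≡M²·M A u v)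
    (sumF-cong (λ w → trans (ℤP.*-comm (sq A u w) (A w v)) (cong₂ _*_ (symm w v) (sq-symmetric u w))))

  -- A·A² = A²·A; in the expansion of both sides by A² = (6 − c)I + (a − c)P + (b − c)N + cJ the
  -- I- and J-terms agree (AJ = JA = 2J), leaving (a + b − 2c)(PN − NP) = 0.
  κ-commutation : ∀ u v → κ * (w⁺⁻ u v - w⁻⁺ u v) ≡ 0ℤ
  κ-commutation u v = begin
    κ * (w⁺⁻ u v - w⁻⁺ u v)
      ≡⟨ difference a b c (A u v) (w⁺⁺ u v) (w⁻⁻ u v) (w⁺⁻ u v) (w⁻⁺ u v) ⟩
    E (A u v) (w⁺⁺ u v) (w⁻⁻ u v) (w⁺⁻ u v) (w⁻⁺ u v) - E (A u v) (w⁺⁺ u v) (w⁻⁻ u v) (w⁻⁺ u v) (w⁺⁻ u v)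
      ≡⟨ cong₂ _-_ (sym (cube-expansion u v)) (sym (trans (cube-expansion v u) transposed)) ⟩
    cube u v - cube v u
      ≡⟨ ℤP.i≡j⇒i-j≡0 (cube-symmetric u v) ⟩
    0ℤ ∎
    where
    open ≡-Reasoning
    E : ℤ → ℤ → ℤ → ℤ → ℤ → ℤ
    E x p q r s = (+ 6 - c) * x + (a - c) * (p - s) + (b - c) * (r - q) + c * + 2
    difference : ∀ a b c x p q r s →
      (a + b - + 2 * c) * (r - s)
        ≡ (+ 6 - c) * x + (a - c) * (p - s) + (b - c) * (r - q) + c * + 2
          - ((+ 6 - c) * x + (a - c) * (p - r) + (b - c) * (s - q) + c * + 2)
    difference = solve-∀
    transposed : E (A v u) (w⁺⁺ v u) (w⁻⁻ v u) (w⁺⁻ v u) (w⁻⁺ v u)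
                   ≡ E (A u v) (w⁺⁺ u v) (w⁻⁻ u v) (w⁻⁺ u v) (w⁺⁻ u v)
    transposed rewrite symm v u | walks-transpose Sign.+ Sign.+ v u | walks-transpose Sign.- Sign.- v u
                     | walks-transpose Sign.+ Sign.- v u | walks-transpose Sign.- Sign.+ v u = refl

  row-equation : c ≡ 0ℤ → Fin n → + 6 + a * + 4 + b * + 2 ≡ + 4
  row-equation c≡0 u = begin
    + 6 + a * + 4 + b * + 2
      ≡⟨ at-c≡0 c≡0 ⟩
    (+ 6 - c) * 1ℤ + (a - c) * + 4 + (b - c) * + 2 + c * sumF one
      ≡⟨ cong₂ _+_ (cong₂ _+_ (cong₂ _+_ (cong ((+ 6 - c) *_) (sym δ-row))
                                         (cong ((a - c) *_) (sym ones-pos)))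
                              (cong ((b - c) *_) (sym ones-neg)))
                   refl ⟩
    (+ 6 - c) * sumF (λ v → 1ℤ * 𝟙 (u ≟ v)) + (a - c) * sumF (λ v → 1ℤ * P v)
      + (b - c) * sumF (λ v → 1ℤ * N v) + c * sumF one
      ≡⟨ sumF-affine one (λ v → 𝟙 (u ≟ v)) P N (+ 6 - c) (a - c) (b - c) c ⟨
    sumF (λ v → 1ℤ * ((+ 6 - c) * 𝟙 (u ≟ v) + (a - c) * P v + (b - c) * N v + c))
      ≡⟨ sumF-cong (λ v → trans (ℤP.*-identityˡ _) (sym (sq-affine u v))) ⟩
    sumF (sq A u)
      ≡⟨ row-sum-sq u ⟩
    + 4 ∎
    where
    open ≡-Reasoning
    one P N : Fin n → ℤ
    one _ = 1ℤ
    P v = 𝟙 (sign? Sign.+ u v)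
    N v = 𝟙 (sign? Sign.- u v)
    δ-row : sumF (λ v → 1ℤ * 𝟙 (u ≟ v)) ≡ 1ℤ
    δ-row = trans (sumF-cong (λ v → cong (1ℤ *_) (𝟙-≟-sym u v))) (sumF-sift one u)
    ones-pos : sumF (λ v → 1ℤ * P v) ≡ + 4
    ones-pos = trans (sumF-cong (λ v → ℤP.*-identityˡ (P v))) (count-sign Sign.+ u)
    ones-neg : sumF (λ v → 1ℤ * N v) ≡ + 2
    ones-neg = trans (sumF-cong (λ v → ℤP.*-identityˡ (N v))) (count-sign Sign.- u)
    at-c≡0 : c ≡ 0ℤ → + 6 + a * + 4 + b * + 2 ≡ (+ 6 - c) * 1ℤ + (a - c) * + 4 + (b - c) * + 2 + c * sumF one
    at-c≡0 c≡0 = subst (λ c → + 6 + a * + 4 + b * + 2 ≡ (+ 6 - c) * 1ℤ + (a - c) * + 4 + (b - c) * + 2 + c * sumF one)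
                       (sym c≡0) (specialise a b (sumF one))
      where
      specialise : ∀ a b s → + 6 + a * + 4 + b * + 2 ≡ (+ 6 - 0ℤ) * 1ℤ + (a - 0ℤ) * + 4 + (b - 0ℤ) * + 2 + 0ℤ * s
      specialise = solve-∀

  on-positive-edge : ∀ {u v} → A u v ≡ 1ℤ → w⁺⁺ u v + w⁻⁻ u v - w⁺⁻ u v - w⁻⁺ u v ≡ a
  on-positive-edge {u} {v} uv = trans (sym (sq≡walks u v)) (pos u v uv)

  on-negative-edge : ∀ {u v} → A u v ≡ -1ℤ → w⁺⁺ u v + w⁻⁻ u v - w⁺⁻ u v - w⁻⁺ u v ≡ b
  on-negative-edge {u} {v} uv = trans (sym (sq≡walks u v)) (neg u v uv)

  κ≢0⇒w⁺⁻≡w⁻⁺ : κ ≢ 0ℤ → ∀ u v → w⁺⁻ u v ≡ w⁻⁺ u v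
  κ≢0⇒w⁺⁻≡w⁻⁺ κ≢0 u v =
    [ (λ κ≡0 → ⊥-elim (κ≢0 κ≡0)) , ℤP.i-j≡0⇒i≡j (w⁺⁻ u v) (w⁻⁺ u v) ]′
      (ℤP.i*j≡0⇒i≡0∨j≡0 κ {w⁺⁻ u v - w⁻⁺ u v} (κ-commutation u v))

  b≢5 : Fin n → b ≢ + 5
  b≢5 u b≡5 =
    let p , up                = some-neighbour Sign.+ u
        x , y , px , py , x≢y = negative-pair p
        ux                    = keeps-positive px (flip up)
        uy                    = keeps-positive py (flip up)
        xy                    = flip (keeps-negative px py (x≢y ∘ sym))
        unique                = (adjacent⇒≢ (edge⁻ px) ∷ adjacent⇒≢ (edge⁻ py) ∷ []) ∷ (x≢y ∷ []) ∷ [] ∷ []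
        z , uz , z∉           = fresh Sign.+ u unique (up ∷ ux ∷ uy ∷ []) ℕP.≤-refl
    in triangle-in-positive-neighbourhood⊥ unique z∉ (up ∷ ux ∷ uy ∷ uz ∷ []) px py xy
         (λ zw → keeps-positive zw (flip uz))
    where
    negative-1+walks≤6 : ∀ {s t} → A s t ≡ -1ℤ → w⁺⁺ s t ≡ + 4 × w⁻⁻ s t ≡ 1ℤ
    negative-1+walks≤6 {s} {t} st = b≡5-profile (profile s t) (trans (on-negative-edge st) b≡5)
                                         (1+walks≤6 (edge⁻ st)) (1+walks≤deg {t = Sign.-} st)
    keeps-positive : ∀ {s t w} → A s t ≡ -1ℤ → A s w ≡ 1ℤ → A w t ≡ 1ℤ
    keeps-positive st = walks≡deg⇒ {Sign.+} {Sign.+} (proj₁ (negative-1+walks≤6 st))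
    keeps-negative : ∀ {s t w} → A s t ≡ -1ℤ → A s w ≡ -1ℤ → w ≢ t → A w t ≡ -1ℤ
    keeps-negative st = 1+walks≡deg⇒ {t = Sign.-} st (cong (_+_ 1ℤ) (proj₂ (negative-1+walks≤6 st)))

  b×2-from-rows : c ≡ 0ℤ → Fin n → b * + 2 ≡ + 4 - + 6 - a * + 4
  b×2-from-rows c≡0 u = trans (isolate a b) (cong (λ x → x - + 6 - a * + 4) (row-equation c≡0 u))
    where
    isolate : ∀ a b → b * + 2 ≡ + 6 + a * + 4 + b * + 2 - + 6 - a * + 4
    isolate = solve-∀

  a×4-from-rows : c ≡ 0ℤ → Fin n → a * + 4 ≡ + 4 - + 6 - b * + 2
  a×4-from-rows c≡0 u = trans (isolate a b) (cong (λ x → x - + 6 - b * + 2) (row-equation c≡0 u))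
    where
    isolate : ∀ a b → a * + 4 ≡ + 6 + a * + 4 + b * + 2 - + 6 - b * + 2
    isolate = solve-∀

  a≢-3 : Fin n → c ≡ 0ℤ ⊎ κ ≢ 0ℤ → Connected A → ¬ Complete A → a ≢ - + 3
  a≢-3 u (inj₁ c≡0) _ _ a≡-3 =
    b≢5 u (ℤP.*-cancelʳ-≡ b (+ 5) (+ 2) (subst (λ a → b * + 2 ≡ + 4 - + 6 - a * + 4) a≡-3 (b×2-from-rows c≡0 u)))
  a≢-3 _ (inj₂ κ≢0) connected ¬complete a≡-3 =
    ¬complete (transitive-adjacency⇒complete adjacency-transitive connected)
    where
    positive-1+walks≤6 : ∀ {s t} → A s t ≡ 1ℤ →
      1ℤ + (w⁺⁺ s t + w⁻⁻ s t + w⁺⁻ s t + w⁻⁺ s t) ≡ + 6 × w⁻⁺ s t ≡ + 2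
    positive-1+walks≤6 {s} {t} st = a≡-3-profile (profile s t) (κ≢0⇒w⁺⁻≡w⁻⁺ κ≢0 s t)
                                         (trans (on-positive-edge st) a≡-3) (1+walks≤6 (edge⁺ st))
    others-adjacent : ∀ {s t k} → A s t ≡ 1ℤ → A s k ≢ 0ℤ → k ≢ t → A k t ≢ 0ℤ
    others-adjacent {s} {t} st = 1+common≡6⇒ (edge⁺ st)
      (subst (λ x → 1ℤ + x ≡ + 6) (sym (common≡walks s t)) (proj₁ (positive-1+walks≤6 st)))
    negatives-across : ∀ {s t w} → A s t ≡ 1ℤ → A s w ≡ -1ℤ → A w t ≡ 1ℤ
    negatives-across st = walks≡deg⇒ {Sign.-} {Sign.+} (proj₂ (positive-1+walks≤6 st))
    adjacency-transitive : ∀ {s t k} → A s t ≢ 0ℤ → A t k ≢ 0ℤ → s ≢ k → A s k ≢ 0ℤ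
    adjacency-transitive {s} {t} {k} s~t t~k s≢k with adjacent-sign (flip-adj s~t)
    ... | inj₁ ts≡1  = flip-adj (others-adjacent ts≡1 t~k (s≢k ∘ sym))
    ... | inj₂ ts≡-1 = via (proj₂ (some-neighbour Sign.+ t))
      where
      via : ∀ {p} → A t p ≡ 1ℤ → A s k ≢ 0ℤ
      via {p} tp with k ≟ p
      ... | yes refl = edge⁺ (negatives-across tp ts≡-1)
      ... | no k≢p   = flip-adj (others-adjacent (flip (negatives-across tp ts≡-1))
                                                 (flip-adj (others-adjacent tp t~k k≢p)) (s≢k ∘ sym))

  b≡4⇒a≡-4 : Fin n → c ≡ 0ℤ ⊎ κ ≢ 0ℤ → a ≢ - + 3 → b ≡ + 4 → a ≡ - + 4
  b≡4⇒a≡-4 u (inj₁ c≡0) _ b≡4 =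
    let p , up = some-neighbour Sign.+ u
    in ⊥-elim (4*profile≢-10 (profile u p) (trans (cong (+ 4 *_) (on-positive-edge up)) 4a≡-10))
    where
    4a≡-10 : + 4 * a ≡ - + 10
    4a≡-10 = trans (ℤP.*-comm (+ 4) a) (subst (λ b → a * + 4 ≡ + 4 - + 6 - b * + 2) b≡4 (a×4-from-rows c≡0 u))
  b≡4⇒a≡-4 u (inj₂ κ≢0) a≢-3 b≡4 =
    let q₁ , q₂ , uq₁ , uq₂ , q₁≢q₂ = negative-pair u
        t , ut , tq₁ , tq₂         = count-∩-overlap (sign? Sign.+ u) (signTo? Sign.+ q₁) (signTo? Sign.+ q₂)
                                       (subst (ℤ._< w⁺⁺ u q₁ + w⁺⁺ u q₂) (sym (count-sign Sign.+ u))
                                         (ℤP.<-≤-trans (ℤ.+<+ (ℕP.n≤1+n 5)) (ℤP.+-mono-≤ (three uq₁) (three uq₂))))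
        two = length≤count (walk? Sign.- Sign.+ u t) ((q₁≢q₂ ∷ []) ∷ [] ∷ [])
                           ((uq₁ , flip tq₁) ∷ (uq₂ , flip tq₂) ∷ [])
    in [ id , ⊥-elim ∘ a≢-3 ]′
         (Sum.map (trans (sym (on-positive-edge ut))) (trans (sym (on-positive-edge ut)))
           (s≡2-profile (profile u t) (κ≢0⇒w⁺⁻≡w⁻⁺ κ≢0 u t) two (1+walks≤6 (edge⁺ ut))))
    where
    three : ∀ {q} → A u q ≡ -1ℤ → + 3 ≤ w⁺⁺ u q
    three {q} uq = b≡4-profile (profile u q) (κ≢0⇒w⁺⁻≡w⁻⁺ κ≢0 u q) (trans (on-negative-edge uq) b≡4)
                               (1+walks≤deg {t = Sign.-} uq)

  module Reconstruction
    (connected : Connected A)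
    (u : Fin n)
    (no-common-positive : ∀ {s t w} → A s t ≡ 1ℤ → A s w ≡ 1ℤ → A w t ≢ 1ℤ)
    (negatives-across : ∀ {s t w} → A s t ≡ 1ℤ → A s w ≡ -1ℤ → A w t ≡ 1ℤ)
    where

    across-negative : ∀ {s t w} → A s t ≡ 1ℤ → A t w ≡ -1ℤ → A s w ≡ 1ℤ
    across-negative st tw = flip (negatives-across (flip st) tw)

    module Vertices₆ {q₁ q₂ p x y} (uq₁ : A u q₁ ≡ -1ℤ) (uq₂ : A u q₂ ≡ -1ℤ) (q₁≢q₂ : q₁ ≢ q₂)
                     (up : A u p ≡ 1ℤ) (px : A p x ≡ -1ℤ) (py : A p y ≡ -1ℤ) (x≢y : x ≢ y) where

      ux : A u x ≡ 1ℤ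
      ux = across-negative up px

      uy : A u y ≡ 1ℤ
      uy = across-negative up py

      unique₃ : Unique (p ∷ x ∷ y ∷ [])
      unique₃ = (adjacent⇒≢ (edge⁻ px) ∷ adjacent⇒≢ (edge⁻ py) ∷ []) ∷ (x≢y ∷ []) ∷ [] ∷ []

      fourth-positive : ∃ λ p′ → A u p′ ≡ 1ℤ × p′ ∉ p ∷ x ∷ y ∷ []
      fourth-positive = fresh Sign.+ u unique₃ (up ∷ ux ∷ uy ∷ []) ℕP.≤-refl

      module Vertices₇ {p′} (up′ : A u p′ ≡ 1ℤ) (p′∉ : p′ ∉ p ∷ x ∷ y ∷ []) where

        unique₄ : Unique (p ∷ x ∷ y ∷ p′ ∷ [])
        unique₄ = unique-snoc unique₃ p′∉

        P[u] : All (λ w → A u w ≡ 1ℤ) (p ∷ x ∷ y ∷ p′ ∷ [])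
        P[u] = up ∷ ux ∷ uy ∷ up′ ∷ []

        positive-of-u : ∀ {w} → A u w ≡ 1ℤ → w ∈ p ∷ x ∷ y ∷ p′ ∷ []
        positive-of-u = exhaust Sign.+ u unique₄ P[u] refl

        x-y : A x y ≡ 0ℤ
        x-y = neither⇒0 (λ xy → no-common-positive xy (flip ux) uy)
                        (λ xy → triangle-in-positive-neighbourhood⊥ unique₃ p′∉ P[u] px py xy (across-negative up′))

        x-p′ : A x p′ ≡ -1ℤ
        x-p′ = let w , xw , w≢p = other-negative (flip px) in
          subst (λ w → A x w ≡ -1ℤ)
                (last-of-four (positive-of-u (across-negative ux xw)) w≢p
                              (distinct-targets xw (loopless x) -1≢0) (distinct-targets xw x-y -1≢0))
                xw

        y-p′ : A y p′ ≡ -1ℤ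
        y-p′ = let w , yw , w≢p = other-negative (flip py) in
          subst (λ w → A y w ≡ -1ℤ)
                (last-of-four (positive-of-u (across-negative uy yw)) w≢p
                              (distinct-targets yw (flip x-y) -1≢0) (distinct-targets yw (loopless y) -1≢0))
                yw

        p-p′ : A p p′ ≡ 0ℤ
        p-p′ = neither⇒0 (λ pp′ → no-common-positive pp′ (flip up) up′)
                         (λ pp′ → [ p′∉ ∘ there ∘ here , p′∉ ∘ there ∘ there ∘ here ]′
                                    (only-negatives px py x≢y pp′))

        q₁-q₂ : A q₁ q₂ ≡ 0ℤ
        q₁-q₂ = neither⇒0 positive negative
          where
          positive : A q₁ q₂ ≢ 1ℤ
          positive q₁q₂ = case trans (sym uq₂) (All.lookup P[u] (exhaust Sign.+ q₁ unique₄
                                 (All.map (λ uw → negatives-across uw uq₁) P[u]) refl q₁q₂)) of λ ()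
          negative : A q₁ q₂ ≢ -1ℤ
          negative q₁q₂ = b≢5 u (trans (sym (on-negative-edge uq₁))
            (p≡4-profile (profile u q₁) (ℤP.≤-antisym (proj₂ (walks-bounded Sign.+ Sign.+ u q₁)) four) one
                         (1+walks≤6 (edge⁻ uq₁))))
            where
            four : + 4 ≤ w⁺⁺ u q₁
            four = length≤count (walk? Sign.+ Sign.+ u q₁) unique₄ (All.map (λ uw → uw , flip (negatives-across uw uq₁)) P[u])
            one : 1ℤ ≤ w⁻⁻ u q₁
            one = length≤count (walk? Sign.- Sign.- u q₁) ([] ∷ []) ((uq₂ , flip q₁q₂) ∷ [])

        module Vertices₈ {y′} (q₁y′ : A q₁ y′ ≡ -1ℤ) (y′≢u : y′ ≢ u) where

          q-positive : ∀ {q w} → A u q ≡ -1ℤ → A u w ≡ 1ℤ → A q w ≡ 1ℤ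
          q-positive uq uw = negatives-across uw uq

          y′-positive : ∀ {w} → A u w ≡ 1ℤ → A y′ w ≡ 1ℤ
          y′-positive uw = negatives-across (q-positive uq₁ uw) q₁y′

          q₂-y′ : A q₂ y′ ≡ -1ℤ
          q₂-y′ = let w , q₂w , w≢u = other-negative (flip uq₂) in
            subst (λ w → A q₂ w ≡ -1ℤ)
                  (last-of-four (positive-of-p (flip (negatives-across (q-positive uq₂ up) q₂w))) w≢u
                                (distinct-targets q₂w (flip q₁-q₂) -1≢0) (distinct-targets q₂w (loopless q₂) -1≢0))
                  q₂w
            where
            unique : Unique (u ∷ q₁ ∷ q₂ ∷ y′ ∷ [])
            unique = (adjacent⇒≢ (edge⁻ uq₁) ∷ adjacent⇒≢ (edge⁻ uq₂) ∷ y′≢u ∘ sym ∷ [])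
                   ∷ (q₁≢q₂ ∷ adjacent⇒≢ (edge⁻ q₁y′) ∷ [])
                   ∷ (distinct-targets q₁-q₂ q₁y′ (λ ()) ∷ []) ∷ [] ∷ []
            positive-of-p : ∀ {w} → A p w ≡ 1ℤ → w ∈ u ∷ q₁ ∷ q₂ ∷ y′ ∷ []
            positive-of-p = exhaust Sign.+ p unique
              (flip up ∷ flip (q-positive uq₁ up) ∷ flip (q-positive uq₂ up) ∷ flip (y′-positive up) ∷ []) refl

          u-y′ : A u y′ ≡ 0ℤ
          u-y′ = neither⇒0 (λ uy′ → case trans (sym q₁y′) (q-positive uq₁ uy′) of λ ())
                           (λ uy′ → [ distinct-targets q₁y′ (loopless q₁) -1≢0 , distinct-targets q₁y′ q₁-q₂ -1≢0 ]′
                                      (only-negatives uq₁ uq₂ q₁≢q₂ uy′))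

          g : Fin 8 → Fin n
          g 0F = u
          g 1F = p
          g 2F = x
          g 3F = y
          g 4F = q₁
          g 5F = q₂
          g 6F = p′
          g 7F = y′

          g-edges : ∀ s t → A (g s) (g t) ≡ S²₈ s t
          g-edges 0F 1F = up
          g-edges 0F 2F = ux
          g-edges 0F 3F = uy
          g-edges 0F 4F = uq₁
          g-edges 0F 5F = uq₂
          g-edges 0F 6F = up′
          g-edges 0F 7F = u-y′
          g-edges 1F 2F = px
          g-edges 1F 3F = py
          g-edges 1F 4F = flip (q-positive uq₁ up)
          g-edges 1F 5F = flip (q-positive uq₂ up)
          g-edges 1F 6F = p-p′
          g-edges 1F 7F = flip (y′-positive up)
          g-edges 2F 3F = x-y
          g-edges 2F 4F = flip (q-positive uq₁ ux)
          g-edges 2F 5F = flip (q-positive uq₂ ux)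
          g-edges 2F 6F = x-p′
          g-edges 2F 7F = flip (y′-positive ux)
          g-edges 3F 4F = flip (q-positive uq₁ uy)
          g-edges 3F 5F = flip (q-positive uq₂ uy)
          g-edges 3F 6F = y-p′
          g-edges 3F 7F = flip (y′-positive uy)
          g-edges 4F 5F = q₁-q₂
          g-edges 4F 6F = q-positive uq₁ up′
          g-edges 4F 7F = q₁y′
          g-edges 5F 6F = q-positive uq₂ up′
          g-edges 5F 7F = q₂-y′
          g-edges 6F 7F = flip (y′-positive up′)
          g-edges 0F 0F = loopless u
          g-edges 1F 1F = loopless p
          g-edges 2F 2F = loopless x
          g-edges 3F 3F = loopless y
          g-edges 4F 4F = loopless q₁
          g-edges 5F 5F = loopless q₂
          g-edges 6F 6F = loopless p′
          g-edges 7F 7F = loopless y′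
          g-edges 1F 0F = flip (g-edges 0F 1F)
          g-edges 2F 0F = flip (g-edges 0F 2F)
          g-edges 3F 0F = flip (g-edges 0F 3F)
          g-edges 4F 0F = flip (g-edges 0F 4F)
          g-edges 5F 0F = flip (g-edges 0F 5F)
          g-edges 6F 0F = flip (g-edges 0F 6F)
          g-edges 7F 0F = flip (g-edges 0F 7F)
          g-edges 2F 1F = flip (g-edges 1F 2F)
          g-edges 3F 1F = flip (g-edges 1F 3F)
          g-edges 4F 1F = flip (g-edges 1F 4F)
          g-edges 5F 1F = flip (g-edges 1F 5F)
          g-edges 6F 1F = flip (g-edges 1F 6F)
          g-edges 7F 1F = flip (g-edges 1F 7F)
          g-edges 3F 2F = flip (g-edges 2F 3F)
          g-edges 4F 2F = flip (g-edges 2F 4F)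
          g-edges 5F 2F = flip (g-edges 2F 5F)
          g-edges 6F 2F = flip (g-edges 2F 6F)
          g-edges 7F 2F = flip (g-edges 2F 7F)
          g-edges 4F 3F = flip (g-edges 3F 4F)
          g-edges 5F 3F = flip (g-edges 3F 5F)
          g-edges 6F 3F = flip (g-edges 3F 6F)
          g-edges 7F 3F = flip (g-edges 3F 7F)
          g-edges 5F 4F = flip (g-edges 4F 5F)
          g-edges 6F 4F = flip (g-edges 4F 6F)
          g-edges 7F 4F = flip (g-edges 4F 7F)
          g-edges 6F 5F = flip (g-edges 5F 6F)
          g-edges 7F 5F = flip (g-edges 5F 7F)
          g-edges 7F 6F = flip (g-edges 6F 7F)

          g-twin : ∀ s → g s ≢ g (twin s)
          g-twin 0F = y′≢u ∘ sym
          g-twin 1F = p′∉ ∘ here ∘ sym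
          g-twin 2F = x≢y
          g-twin 3F = x≢y ∘ sym
          g-twin 4F = q₁≢q₂
          g-twin 5F = q₁≢q₂ ∘ sym
          g-twin 6F = p′∉ ∘ here
          g-twin 7F = y′≢u

          g-injective : ∀ {s t} → g s ≡ g t → s ≡ t
          g-injective {s} {t} gs≡gt with s ≟ t
          ... | yes s≡t = s≡t
          ... | no s≢t  = ⊥-elim ([ s≢t , (λ t≡twin → g-twin s (trans gs≡gt (cong g t≡twin))) ]′
                                    (S²₈-non-adjacent⇒twins s t
                                      (trans (sym (g-edges s t)) (trans (cong (A (g s)) (sym gs≡gt)) (loopless (g s))))))

          image-closed : ∀ {j k} → (∃ λ s → g s ≡ j) → A j k ≢ 0ℤ → ∃ λ t → g t ≡ k
          image-closed {k = k} (s , refl) s~k = [ in-image Sign.+ , in-image Sign.- ]′ (adjacent-sign s~k)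
            where
            in-image : ∀ σ → A (g s) k ≡ σ ◃ 1 → ∃ λ t → g t ≡ k
            in-image σ sk =
              let t , _ , k≡gt = ∈-map⁻ g (exhaust σ (g s)
                                   (Unique.map⁺ g-injective (filter⁺ (λ t → S²₈ s t ℤ.≟ σ ◃ 1) (allFin⁺ 8)))
                                   (All-map⁺ (All.map (λ {t} st → trans (g-edges s t) st)
                                                      (all-filter (λ t → S²₈ s t ℤ.≟ σ ◃ 1) (allFin 8))))
                                   (trans (length-map g (S²₈-neighbours σ s)) (S²₈-degree σ s)) sk)
              in t , sym k≡gt

          g-iso : Iso A S²₈
          g-iso = embedding⇒Iso g g-edges g-injective (λ k → reach-closed image-closed (connected u k) (0F , refl))

    iso : Iso A S²₈
    iso =
      let q₁ , q₂ , uq₁ , uq₂ , q₁≢q₂ = negative-pair u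
          p , up                    = some-neighbour Sign.+ u
          x , y , px , py , x≢y     = negative-pair p
          open Vertices₆ uq₁ uq₂ q₁≢q₂ up px py x≢y
          p′ , up′ , p′∉            = fourth-positive
          open Vertices₇ up′ p′∉
          y′ , q₁y′ , y′≢u          = other-negative (flip uq₁)
          open Vertices₈ q₁y′ y′≢u
      in g-iso

  a≡-4⇒Iso : Fin n → c ≡ 0ℤ ⊎ κ ≢ 0ℤ → Connected A → a ≡ - + 4 → Iso A S²₈
  a≡-4⇒Iso u (inj₁ c≡0) _ a≡-4 =
    let q , uq = some-neighbour Sign.- u
    in ⊥-elim (profile≢7 (profile u q) (1+walks≤6 (edge⁻ uq)) (trans (on-negative-edge uq) b≡7))
    where
    b≡7 : b ≡ + 7
    b≡7 = ℤP.*-cancelʳ-≡ b (+ 7) (+ 2) (subst (λ a → b * + 2 ≡ + 4 - + 6 - a * + 4) a≡-4 (b×2-from-rows c≡0 u))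
  a≡-4⇒Iso u (inj₂ κ≢0) connected a≡-4 =
    Reconstruction.iso connected u no-common-positive negatives-across
    where
    positive-1+walks≤6 : ∀ {s t} → A s t ≡ 1ℤ → w⁺⁺ s t ≡ 0ℤ × w⁻⁺ s t ≡ + 2
    positive-1+walks≤6 {s} {t} st = a≡-4-profile (profile s t) (κ≢0⇒w⁺⁻≡w⁻⁺ κ≢0 s t)
                                         (trans (on-positive-edge st) a≡-4) (1+walks≤6 (edge⁺ st))
    no-common-positive : ∀ {s t w} → A s t ≡ 1ℤ → A s w ≡ 1ℤ → A w t ≢ 1ℤ
    no-common-positive st = walks≡0⇒ {Sign.+} {Sign.+} (proj₁ (positive-1+walks≤6 st))
    negatives-across : ∀ {s t w} → A s t ≡ 1ℤ → A s w ≡ -1ℤ → A w t ≡ 1ℤ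
    negatives-across st = walks≡deg⇒ {Sign.-} {Sign.+} (proj₂ (positive-1+walks≤6 st))

lemma3p4 : ∀ {n : ℕ} (A : SMat n) (a b c : ℤ)
    → IsSignedGraph A
    → IsSRSG A 6 a b c
    → C₁ A a b c ⊎ C₄ A a b c ⊎ C₅ A a b c
    → Connected A
    → ¬ Complete A
    → Regular A 6
    → NetRegular A (+ 2)
    → (a ≢ - (+ 3))
      × (a ≡ - (+ 4) → Iso A S²₈ × IsSRSG S²₈ 6 (- (+ 4)) (+ 4) (+ 6))
      × (b ≢ + 5)
      × (b ≡ + 4 → a ≡ - (+ 4))
lemma3p4 A a b c G srsg class connected ¬complete regular net-regular =
  ¬a≡-3 , (λ a≡-4 → a≡-4⇒Iso u cases connected a≡-4 , S²₈-srsg) , b≢5 u , b≡4⇒a≡-4 u cases ¬a≡-3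
  where
  open StronglyRegular62 A G regular net-regular srsg
  u : Fin _
  u = some-vertex (IsSRSG.notEdgeless srsg)
  cases : c ≡ 0ℤ ⊎ κ ≢ 0ℤ
  cases = c≡0⊎κ≢0 class ¬complete
  ¬a≡-3 : a ≢ - + 3
  ¬a≡-3 = a≢-3 u cases connected ¬complete
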